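{- For every integer $k\ge 1$, the $(3k+4)$-dimensional Weisfeiler-Leman algorithm identifies every graph of rank width at most $k$; that is, if $G$ has rank width at most $k$ and $H$ is any graph with $H\not\cong G$, then the $(3k+4)$-dimensional Weisfeiler-Leman algorithm distinguishes $G$ and $H$.
   Context: All graphs are finite, simple and undirected; graphs may carry a vertex colouring, and isomorphisms must preserve vertex colours (an uncoloured graph is one where all vertices have the same colour). For a graph $G$ and $X\subseteq V(G)$ let $\overline X=V(G)\setminus X$ and let $\rho_G(X)$ be the rank over $\mathbb F_2$ of the $X\times\overline X$ matrix $M$ with $M_{x,y}=1$ iff $xy\in E(G)$. A rank decomposition of $G$ is a pair $(T,\gamma)$ where $T$ is a rooted binary tree and $\gamma:V(T)\to 2^{V(G)}$ satisfies: $\gamma(r)=V(G)$ for the root $r$; for each internal node $t$ with children $s_1,s_2$, $\gamma(t)$ is the disjoint union of $\gamma(s_1)$ and $\gamma(s_2)$; and $|\gamma(t)|=1$ for every leaf $t$. Its width is $\max_{t}\rho_G(\gamma(t))$, and the rank width of $G$ is the minimum width of a rank decomposition of $G$. The $\ell$-dimensional Weisfeiler-Leman algorithm ($\ell\ge2$): for a vertex-coloured graph $G$, the initial colour $\chi_0(v_1,\dots,v_\ell)$ of an $\ell$-tuple is its atomic type (the colours of the $v_i$, which pairs are equal, which pairs are adjacent); iteratively $\chi_{i+1}(\bar v)=(\chi_i(\bar v),\{\!\{(\chi_i(\bar v[w/1]),\dots,\chi_i(\bar v[w/\ell]))\mid w\in V(G)\}\!\})$ where $\bar v[w/j]$ replaces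 the $j$-th entry of $\bar v$ by $w$. The algorithm distinguishes $G$ and $H$ if for some $i$ and some colour $c$ the number of $\ell$-tuples of $G$ of colour $c$ under $\chi_i$ differs from the corresponding number for $H$. It identifies $G$ if it distinguishes $G$ from every graph not isomorphic to $G$. -}

module Defs where

open import Data.Nat using (ℕ; zero; suc)
open import Data.Fin using (Fin; _≟_)
open import Data.Bool using (Bool; true; false; _∧_; _∨_; _xor_; if_then_else_)
open import Data.Product using (Σ; ∃; _×_; _,_)
open import Data.Sum using (_⊎_)
open import Data.Empty using (⊥)
open import Relation.Nullary using (¬_; does)
open import Relation.Binary.PropositionalEquality using (_≡_)
open import Function.Bundles using (_↔_; Inverse)
open import Function.Definitions using (Injective)
open import Data.Refinement using (Refinement)

record Graph : Set where
  field
    n      : ℕ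
    adj    : Fin n → Fin n → Bool
    sym    : ∀ x y → adj x y ≡ adj y x
    irrefl : ∀ x → adj x x ≡ false
    col    : Fin n → ℕ

open Graph public

V : Graph → Set
V G = Fin (n G)

Iso : Graph → Graph → Set
Iso G H = Σ (V G ↔ V H) λ π →
  (∀ x y → adj G x y ≡ adj H (Inverse.to π x) (Inverse.to π y)) ×
  (∀ x → col G x ≡ col H (Inverse.to π x))

VSet : Graph → Set
VSet G = V G → Bool

parity : ∀ {m} → (Fin m → Bool) → Bool
parity {zero}  f = false
parity {suc m} f = f Fin.zero xor parity (λ i → f (Fin.suc i))

-- ρ_G(X) ≤ r : the X × X̄ adjacency matrix over F₂ has rank ≤ r, i.e.
-- every family of r+1 distinct rows (indexed by distinct vertices of X)
-- is linearly dependent over F₂: some nonempty subfamily sums to the zero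
-- vector (indexed by X̄).
CutRank≤ : (G : Graph) → VSet G → ℕ → Set
CutRank≤ G X r =
  (s : Fin (suc r) → V G) → Injective _≡_ _≡_ s → (∀ i → X (s i) ≡ true) →
  Σ (Fin (suc r) → Bool) λ S →
    (∃ λ i → S i ≡ true) ×
    (∀ y → X y ≡ false → parity (λ i → S i ∧ adj G (s i) y) ≡ false)

data LTree (G : Graph) : Set where
  leaf : VSet G → LTree G
  node : VSet G → LTree G → LTree G → LTree G

γ : ∀ {G} → LTree G → VSet G
γ (leaf X)     = X
γ (node X _ _) = X

WellLabelled : ∀ {G} → LTree G → Set
WellLabelled {G} (leaf X) = Σ (V G) λ v → ∀ x → (X x ≡ true → x ≡ v) × (x ≡ v → X x ≡ true)
WellLabelled {G} (node X t₁ t₂) =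
  (∀ x → X x ≡ (γ t₁ x ∨ γ t₂ x)) × (∀ x → (γ t₁ x ∧ γ t₂ x) ≡ false) ×
  WellLabelled t₁ × WellLabelled t₂

IsRankDecomposition : (G : Graph) → LTree G → Set
IsRankDecomposition G T = (∀ x → γ T x ≡ true) × WellLabelled T

Width≤ : (G : Graph) → LTree G → ℕ → Set
Width≤ G (leaf X)       k = CutRank≤ G X k
Width≤ G (node X t₁ t₂) k = CutRank≤ G X k × Width≤ G t₁ k × Width≤ G t₂ k

RankWidth≤ : Graph → ℕ → Set
RankWidth≤ G k = Σ (LTree G) λ T → IsRankDecomposition G T × Width≤ G T k

Tuple : ℕ → Graph → Set
Tuple ℓ G = Fin ℓ → V G

_[_/_] : ∀ {ℓ G} → Tuple ℓ G → V G → Fin ℓ → Tuple ℓ G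
(u [ w / j ]) i = if does (i ≟ j) then w else u i

AtpEq : ∀ {ℓ} (G H : Graph) → Tuple ℓ G → Tuple ℓ H → Set
AtpEq G H u v = ∀ i j →
  (col G (u i) ≡ col H (v i)) ×
  ((u i ≡ u j → v i ≡ v j) × (v i ≡ v j → u i ≡ u j)) ×
  (adj G (u i) (u j) ≡ adj H (v i) (v j))

-- SameColour i G H u v  :⇔  χ_i(u) = χ_i(v)  (colours compared across graphs).
-- Equality of the multisets in the refinement step is the existence of a
-- bijection V(G) → V(H) matching the indexed elements.
SameColour : ∀ ℓ → ℕ → (G H : Graph) → Tuple ℓ G → Tuple ℓ H → Set
SameColour ℓ zero    G H u v = AtpEq G H u v
SameColour ℓ (suc i) G H u v =
  SameColour ℓ i G H u v ×
  Σ (V G ↔ V H) λ π → ∀ w j →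
    SameColour ℓ i G H (_[_/_] {ℓ} {G} u w j) (_[_/_] {ℓ} {H} v (Inverse.to π w) j)

ColourClass : ∀ ℓ → ℕ → (G K : Graph) → Tuple ℓ K → Set
ColourClass ℓ i G K c = Refinement (Tuple ℓ G) λ u → SameColour ℓ i G K u c

-- ℓ-WL distinguishes G and H: for some round i and some colour c (a colour
-- not attained in G or H has count 0 in both, so it suffices to range over
-- colours of tuples of G or of H) the numbers of tuples of colour c differ.
Distinguishes : ℕ → Graph → Graph → Set
Distinguishes ℓ G H = Σ ℕ λ i →
  (Σ (Tuple ℓ G) λ c → ¬ (ColourClass ℓ i G G c ↔ ColourClass ℓ i H G c)) ⊎
  (Σ (Tuple ℓ H) λ c → ¬ (ColourClass ℓ i G H c ↔ ColourClass ℓ i H H c))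

-- The goal reduces to ⊥: if 3k+4 dimensional Weisfeiler-Leman does not separate
-- a tuple of G from some tuple of H after the (explicitly bounded) number of
-- rounds needed for stabilisation, then Duplicator has a winning strategy, and
-- we derive ¬ ¬ Iso H G. Since only ⊥ is wanted, all finitely many case
-- distinctions are made under a double negation.
--
-- For a node t of the rank decomposition with X = γ t, pebble row vertices
-- A ⊆ X and column vertices B ⊆ X̄, at most k each, spanning the cut. Adjacency
-- across the cut is then a bilinear function g of the adjacencies to A and B.
-- Draw an arc x → y whenever adj x y differs from g x y: no arc leaves X, so the
-- strong components of X stay inside X, and between distinct components
-- adjacency is given by g read in one of the two directions, which Duplicator
-- can tell because he preserves the number of vertices reachable from a vertex.
--
-- By induction on t, Duplicator's pairs v ↦ v′ over the pebbles on A ∪ B extend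
-- to pointed isomorphisms between the strong components of v and v′. For a node
-- with children X₁ and X₂, bases A₁ ⊇ A ∩ X₁ and A₂ ⊇ A ∩ X₂ of the children,
-- together with B, serve all three cuts, which takes 3k pebbles. The isomorphisms
-- of the child components preserve even the colours over A₁ ∪ A₂ ∪ B, because two
-- of them differ by an automorphism of a component, which extends by the identity
-- to the whole graph. Hence they can be glued greedily, one component at a time:
-- an uncovered vertex always has an uncovered partner of the same colour.

module Submission where

open import Defs renaming (sym to adj-sym)
open import Data.Nat using (ℕ; zero; suc; _≤_; _<_; _+_; _*_; _∸_; _^_; s≤s; z≤n)
import Data.Nat.Properties as ℕₚ
open import Data.Fin using (Fin; _≟_; toℕ; punchOut; punchIn; combine; remQuot; finToFun; funToFin; fromℕ<; inject≤)
  renaming (zero to fz; suc to fs)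
import Data.Fin.Properties as Finₚ
open import Data.Bool using (Bool; true; false; _∧_; _∨_; _xor_; not; if_then_else_)
import Data.Bool.Properties as Boolₚ
open import Data.Product using (Σ; ∃; _×_; _,_; proj₁; proj₂; swap)
open import Data.Sum using (_⊎_; inj₁; inj₂)
open import Data.Empty using (⊥; ⊥-elim; ⊥-elim-irr)
open import Data.Irrelevant using ([_])
open import Data.Refinement using () renaming (_,_ to _,ᵣ_)
open import Data.List using (List; []; _∷_; _++_; length; lookup; filter; allFin; map)
import Data.List.Properties as Listₚ
import Data.List.Membership.DecPropositional as DecMembership
open import Data.List.Membership.Propositional using (_∈_; find; lose)
open import Data.List.Membership.Propositional.Properties
  using (∈-++⁺ˡ; ∈-++⁺ʳ; ∈-++⁻; ∈-filter⁺; ∈-filter⁻; ∈-allFin; ∈-lookup; ∈-map⁺; ∈-map⁻)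
open import Data.List.Relation.Binary.Subset.Propositional using (_⊆_)
import Data.List.Relation.Binary.Subset.Propositional.Properties as ⊆ₚ
open import Data.List.Relation.Unary.Any using (here; there; any?)
open import Data.List.Relation.Unary.Unique.Propositional using (Unique)
import Data.List.Relation.Unary.Unique.Propositional.Properties as Uniqueₚ
open import Data.List.Relation.Unary.AllPairs using ([]; _∷_)
import Data.List.Relation.Unary.All as All
open import Data.List.Relation.Unary.All.Properties using (¬Any⇒All¬)
open import Relation.Nullary using (¬_; Dec; yes; no; does)
open import Relation.Nullary.Decidable using (dec-true; dec-false; decidable-stable; _×-dec_; _⊎-dec_; ¬?; ¬¬-excluded-middle)
open import Relation.Binary.Construct.Closure.ReflexiveTransitive as Star using (Star; ε; _◅_; _◅◅_)
open import Relation.Binary.PropositionalEquality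
  using (_≡_; _≢_; refl; sym; trans; cong; cong₂; subst; _≗_; module ≡-Reasoning)
open import Function using (_∘_; id)
open import Function.Bundles using (_↔_; Inverse; Injection; mk↔ₛ′)
open import Function.Properties.Inverse using (↔⇒↣)
open import Function.Definitions using (Injective)
open import Function.Construct.Identity using (↔-id)
open import Function.Construct.Symmetry using (↔-sym)
open import Function.Construct.Composition using (_↔-∘_)

-- Double negation and injections of finite sets

DN : Set → Set
DN A = ¬ ¬ A

return : {A : Set} → A → DN A
return a k = k a

_>>=_ : {A B : Set} → DN A → (A → DN B) → DN B
(m >>= f) k = m (λ a → f a k)

-- Double negation passes through this quantifier because its domain is finite.
dn-∀ : ∀ {m} {P : Fin m → Set} → (∀ x → DN (P x)) → DN (∀ x → P x)
dn-∀ {zero}  h = return λ ()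
dn-∀ {suc m} h = do
  p₀ ← h fz
  ps ← dn-∀ (λ x → h (fs x))
  return λ { fz → p₀ ; (fs x) → ps x }

dn-→ : {A B : Set} → (A → DN B) → DN (A → B)
dn-→ h k = k (λ a → ⊥-elim (h a (λ b → k (λ _ → b))))

to-injective : {A B : Set} (π : A ↔ B) → ∀ {x y} → Inverse.to π x ≡ Inverse.to π y → x ≡ y
to-injective π = Injection.injective (↔⇒↣ π)

-- Punching a missed `w` out of the codomain would inject `Fin (suc m)` into `Fin m`.
injective⇒surjective : ∀ {m} (f : Fin m → Fin m) → Injective _≡_ _≡_ f →
  ∀ w → ¬ (∀ z → f z ≢ w)
injective⇒surjective {suc m} f inj w miss =
  ℕₚ.<-irrefl refl (Finₚ.injective⇒≤ {f = λ z → punchOut (miss z ∘ sym)}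
    (λ {x} {y} eq → inj (Finₚ.punchOut-injective (miss x ∘ sym) (miss y ∘ sym) eq)))

-- Since `f` maps `P` into itself, extending it by the identity outside `P` keeps it injective, and
-- a value missed on `P` is then missed altogether.
injectiveOn⇒surjectiveOn : ∀ {m} {P : Fin m → Set} → (∀ x → Dec (P x)) → (f : Fin m → Fin m) →
  (∀ x → P x → P (f x)) → (∀ x y → P x → P y → f x ≡ f y → x ≡ y) →
  ∀ w → P w → ¬ (∀ z → P z → f z ≢ w)
injectiveOn⇒surjectiveOn {m} {P} P? f pres inj w pw miss =
  injective⇒surjective g g-inj w g-miss
  where
  g : Fin m → Fin m
  g x with P? x
  ... | yes _ = f x
  ... | no _  = x
  g-inj : Injective _≡_ _≡_ g
  g-inj {x} {y} eq with P? x | P? y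
  ... | yes px | yes py = inj x y px py eq
  ... | yes px | no ¬py = ⊥-elim (¬py (subst P eq (pres x px)))
  ... | no ¬px | yes py = ⊥-elim (¬px (subst P (sym eq) (pres y py)))
  ... | no _   | no _   = eq
  g-miss : ∀ z → g z ≢ w
  g-miss z eq with P? z
  ... | yes pz = miss z pz eq
  ... | no ¬pz = ¬pz (subst P (sym eq) pw)

-- Equality of colours: congruence, isomorphism invariance, equivalence

module _ {ℓ : ℕ} where

  upd-cong : ∀ {K} {u u' : Tuple ℓ K} {w w'} j → u ≗ u' → w ≡ w' →
    (_[_/_] {ℓ} {K} u w j) ≗ (_[_/_] {ℓ} {K} u' w' j)
  upd-cong j h refl i with i ≟ j
  ... | yes _ = refl
  ... | no _  = h i

  upd-natural : ∀ {K L} (f : V K → V L) (u : Tuple ℓ K) w j →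
    (f ∘ _[_/_] {ℓ} {K} u w j) ≗ (_[_/_] {ℓ} {L} (f ∘ u) (f w) j)
  upd-natural f u w j i with i ≟ j
  ... | yes _ = refl
  ... | no _  = refl

  sameColour-cong : ∀ i {K L} {u u' : Tuple ℓ K} {v v' : Tuple ℓ L} → u ≗ u' → v ≗ v' →
    SameColour ℓ i K L u v → SameColour ℓ i K L u' v'
  sameColour-cong zero {K} {L} {u} {u'} {v} {v'} hu hv atp i j
    rewrite sym (hu i) | sym (hu j) | sym (hv i) | sym (hv j) = atp i j
  sameColour-cong (suc r) {K} {L} hu hv (c , π , h) =
    sameColour-cong r hu hv c , π , λ w j →
      sameColour-cong r (upd-cong {K} j hu refl) (upd-cong {L} j hv refl) (h w j)

  -- The isomorphism itself serves as the bijection in every round, since it commutes with replacing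
  -- an entry.
  sameColour-iso : ∀ i {K L} (σ : Iso K L) (u : Tuple ℓ K) →
    SameColour ℓ i K L u (Inverse.to (proj₁ σ) ∘ u)
  sameColour-iso zero (σ , adj-σ , col-σ) u i j =
    col-σ (u i) , (cong (Inverse.to σ) , to-injective σ) , adj-σ (u i) (u j)
  sameColour-iso (suc r) {K} {L} σ u = sameColour-iso r σ u , proj₁ σ , λ w j →
    sameColour-cong r {u = _[_/_] {ℓ} {K} u w j} (λ _ → refl) (upd-natural {K} {L} (Inverse.to (proj₁ σ)) u w j)
      (sameColour-iso r σ (_[_/_] {ℓ} {K} u w j))

  iso-refl : ∀ {K} → Iso K K
  iso-refl = ↔-id _ , (λ _ _ → refl) , (λ _ → refl)

  sameColour-refl : ∀ i {K} (u : Tuple ℓ K) → SameColour ℓ i K K u u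
  sameColour-refl i {K} u = sameColour-iso i (iso-refl {K}) u

  sameColour-sym : ∀ i {K L} {u : Tuple ℓ K} {v : Tuple ℓ L} →
    SameColour ℓ i K L u v → SameColour ℓ i L K v u
  sameColour-sym zero atp i j with atp i j
  ... | c , (f , g) , a = sym c , (g , f) , sym a
  sameColour-sym (suc r) {K} {L} {u} {v} (c , π , h) = sameColour-sym r c , ↔-sym π , λ w j →
    sameColour-sym r (sameColour-cong r {u = _[_/_] {ℓ} {K} u (Inverse.from π w) j} (λ _ → refl)
      (upd-cong {L} {v} j (λ _ → refl) (Inverse.strictlyInverseˡ π w)) (h (Inverse.from π w) j))

  sameColour-trans : ∀ i {K L M} {u : Tuple ℓ K} {v : Tuple ℓ L} {w : Tuple ℓ M} →
    SameColour ℓ i K L u v → SameColour ℓ i L M v w → SameColour ℓ i K M u w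
  sameColour-trans zero p q i j with p i j | q i j
  ... | c , (f , g) , a | c' , (f' , g') , a' = trans c c' , (f' ∘ f , g ∘ g') , trans a a'
  sameColour-trans (suc r) (c , π , h) (c' , π' , h') = sameColour-trans r c c' , π' ↔-∘ π ,
    λ w j → sameColour-trans r (h w j) (h' (Inverse.to π w) j)

-- Deleting position j from f leaves some j′ unused, so replacing the entry at
-- j of u ∘ f by w is a reindexing of the tuple obtained from u by replacing
-- the entry at j′ by w.
module _ {ℓ : ℕ} where

  unused : (f : Fin (suc ℓ) → Fin (suc ℓ)) (j : Fin (suc ℓ)) →
    ∃ λ j' → ∀ i → i ≢ j → f i ≢ j'
  unused f j with Finₚ.any? (λ j' → Finₚ.all? (λ i → dec i j'))
    where
    dec : ∀ i j' → Dec (f (punchIn j i) ≢ j')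
    dec i j' with f (punchIn j i) ≟ j'
    ... | yes eq = no (λ ne → ne eq)
    ... | no ne  = yes ne
  ... | yes (j' , h) = j' , λ i i≢j eq → h (punchOut (i≢j ∘ sym))
          (trans (cong f (Finₚ.punchIn-punchOut (i≢j ∘ sym))) eq)
  ... | no ¬h = ⊥-elim (ℕₚ.<-irrefl refl (Finₚ.injective⇒≤ {f = g} g-inj))
    where
    pre : ∀ j' → ∃ λ i → f (punchIn j i) ≡ j'
    pre j' with Finₚ.any? (λ i → f (punchIn j i) ≟ j')
    ... | yes p = p
    ... | no ¬p = ⊥-elim (¬h (j' , λ i eq → ¬p (i , eq)))
    g : Fin (suc ℓ) → Fin ℓ
    g j' = proj₁ (pre j')
    g-inj : Injective _≡_ _≡_ g
    g-inj {x} {y} eq = trans (sym (proj₂ (pre x))) (trans (cong (f ∘ punchIn j) eq) (proj₂ (pre y)))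

  redirect : (Fin (suc ℓ) → Fin (suc ℓ)) → (j j' : Fin (suc ℓ)) → Fin (suc ℓ) → Fin (suc ℓ)
  redirect f j j' i = if does (i ≟ j) then j' else f i

  upd-reindex : ∀ {K} (u : Tuple (suc ℓ) K) f j j' w → (∀ i → i ≢ j → f i ≢ j') →
    (_[_/_] {suc ℓ} {K} u w j' ∘ redirect f j j') ≗ (_[_/_] {suc ℓ} {K} (u ∘ f) w j)
  upd-reindex u f j j' w h i with i ≟ j
  ... | yes _ with j' ≟ j'
  ...   | yes _ = refl
  ...   | no ne = ⊥-elim (ne refl)
  upd-reindex u f j j' w h i | no ne with f i ≟ j'
  ... | yes eq = ⊥-elim (h i ne eq)
  ... | no _ = refl

  sameColour-reindex : ∀ i {K L} {u : Tuple (suc ℓ) K} {v : Tuple (suc ℓ) L} →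
    (f : Fin (suc ℓ) → Fin (suc ℓ)) →
    SameColour (suc ℓ) i K L u v → SameColour (suc ℓ) i K L (u ∘ f) (v ∘ f)
  sameColour-reindex zero f c i j = c (f i) (f j)
  sameColour-reindex (suc r) {K} {L} {u} {v} f (c , π , h) = sameColour-reindex r f c , π , step
    where
    step : ∀ w j → SameColour (suc ℓ) r K L (_[_/_] {suc ℓ} {K} (u ∘ f) w j)
                     (_[_/_] {suc ℓ} {L} (v ∘ f) (Inverse.to π w) j)
    step w j with unused f j
    ... | j' , free = sameColour-cong r (upd-reindex {K} u f j j' w free)
          (upd-reindex {L} v f j j' (Inverse.to π w) free)
          (sameColour-reindex r (redirect f j j') (h w j'))

-- Stabilisation of colour refinement

Stable : ℕ → ℕ → Graph → Graph → Set
Stable ℓ i K L = ∀ u v → SameColour ℓ i K L u v → SameColour ℓ (suc i) K L u v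

-- The bijection `π` matches tuples of equal colour at round `i`; stability lifts these to round
-- `suc i`, so `π` serves one round later as well.
stable-suc : ∀ {ℓ i K L} → Stable ℓ i K L → Stable ℓ (suc i) K L
stable-suc st u v c@(_ , π , h) = c , π , λ w j → st _ _ (h w j)

stable-≤ : ∀ {ℓ i K L} d → Stable ℓ i K L → Stable ℓ (d + i) K L
stable-≤ zero st = st
stable-≤ (suc d) st = stable-suc (stable-≤ d st)

sameColour-≤ : ∀ {ℓ K L u v} i d → SameColour ℓ (d + i) K L u v → SameColour ℓ i K L u v
sameColour-≤ i zero c = c
sameColour-≤ i (suc d) (c , _) = sameColour-≤ i d c

pairs : ℕ → Graph → Graph → ℕ
pairs ℓ K L = (n K ^ ℓ) * (n L ^ ℓ)

-- Each unstable round separates some pair of tuples for good, and there are only `pairs ℓ K L`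
-- pairs. If the first `suc M` rounds were all unstable, two of them would lose the same pair.
stabilises : ∀ ℓ K L → DN (Stable ℓ (pairs ℓ K L) K L)
stabilises ℓ K L ¬st = dn-∀ lost (λ pick → contra pick)
  where
  M = pairs ℓ K L
  left : Fin M → Tuple ℓ K
  left x = finToFun (proj₁ (remQuot {n K ^ ℓ} (n L ^ ℓ) x))
  right : Fin M → Tuple ℓ L
  right x = finToFun (proj₂ (remQuot {n K ^ ℓ} (n L ^ ℓ) x))
  P : ℕ → Fin M → Set
  P i x = SameColour ℓ i K L (left x) (right x)
  code : Tuple ℓ K → Tuple ℓ L → Fin M
  code u v = combine (funToFin u) (funToFin v)
  left-code : ∀ u v → left (code u v) ≗ u
  left-code u v j = trans
    (cong (λ p → finToFun (proj₁ p) j) (Finₚ.remQuot-combine {n K ^ ℓ} {n L ^ ℓ} (funToFin u) (funToFin v)))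
    (Finₚ.finToFun-funToFin u j)
  right-code : ∀ u v → right (code u v) ≗ v
  right-code u v j = trans
    (cong (λ p → finToFun (proj₂ p) j) (Finₚ.remQuot-combine {n K ^ ℓ} {n L ^ ℓ} (funToFin u) (funToFin v)))
    (Finₚ.finToFun-funToFin v j)
  Lost : Fin (suc M) → Set
  Lost i = ∃ λ x → P (toℕ i) x × ¬ P (suc (toℕ i)) x
  -- Stability at an earlier round would persist up to round `M`.
  unstable : ∀ i → i ≤ M → ¬ Stable ℓ i K L
  unstable i i≤M st = ¬st (subst (λ m → Stable ℓ m K L) (ℕₚ.m∸n+n≡m i≤M) (stable-≤ (M ∸ i) st))
  lost : ∀ i → DN (Lost i)
  lost i ¬lost = dn-∀ {P = λ x → P (toℕ i) x → P (suc (toℕ i)) x}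
    (λ x → dn-→ (λ p ¬p → ¬lost (x , p , ¬p)))
    λ all → unstable (toℕ i) (ℕₚ.≤-pred (Finₚ.toℕ<n i)) λ u v c →
      sameColour-cong (suc (toℕ i)) (left-code u v) (right-code u v)
        (all (code u v) (sameColour-cong (toℕ i) (λ j → sym (left-code u v j)) (λ j → sym (right-code u v j)) c))
  contra : ¬ (∀ i → Lost i)
  contra pick with Finₚ.pigeonhole (ℕₚ.n<1+n M) (λ i → proj₁ (pick i))
  ... | i , j , i<j , eq with pick i | pick j
  ...   | x , _ , ¬p | y , p , _ rewrite eq =
    ¬p (sameColour-≤ (suc (toℕ i)) (toℕ j ∸ suc (toℕ i))
         (subst (λ m → P m y) (sym (ℕₚ.m∸n+n≡m i<j)) p))

-- Sums over F₂

true≢false : true ≢ false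
true≢false ()

¬true⇒false : ∀ {b} → ¬ (b ≡ true) → b ≡ false
¬true⇒false {true}  h = ⊥-elim (h refl)
¬true⇒false {false} h = refl

∧-true : ∀ {a b} → a ∧ b ≡ true → a ≡ true × b ≡ true
∧-true {true} {true} _ = refl , refl

xor-true : ∀ {a b} → a xor b ≡ true → a ≡ true ⊎ b ≡ true
xor-true {true}  _ = inj₁ refl
xor-true {false} h = inj₂ h

xor-cancel : ∀ {a b} → a xor b ≡ false → a ≡ b
xor-cancel {true}  {true}  _ = refl
xor-cancel {false} {false} _ = refl

xor-interchange : ∀ a b c d → (a xor b) xor (c xor d) ≡ (a xor c) xor (b xor d)
xor-interchange true  true  true  d = refl
xor-interchange true  true  false d = sym (Boolₚ.not-involutive d)
xor-interchange true  false c     d = Boolₚ.not-distribˡ-xor c d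
xor-interchange false true  true  d = refl
xor-interchange false true  false d = refl
xor-interchange false false c     d = refl

parity-cong : ∀ {m} {f g : Fin m → Bool} → f ≗ g → parity f ≡ parity g
parity-cong {zero}  h = refl
parity-cong {suc m} h = cong₂ _xor_ (h fz) (parity-cong (h ∘ fs))

parity-zero : ∀ {m} {f : Fin m → Bool} → (∀ i → f i ≡ false) → parity f ≡ false
parity-zero {zero}  h = refl
parity-zero {suc m} h = cong₂ _xor_ (h fz) (parity-zero (h ∘ fs))

parity-xor : ∀ {m} (f g : Fin m → Bool) → parity (λ i → f i xor g i) ≡ parity f xor parity g
parity-xor {zero}  f g = refl
parity-xor {suc m} f g = trans (cong ((f fz xor g fz) xor_) (parity-xor (f ∘ fs) (g ∘ fs)))
  (xor-interchange (f fz) (g fz) _ _)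

parity-∧ˡ : ∀ {m} b (f : Fin m → Bool) → parity (λ i → b ∧ f i) ≡ b ∧ parity f
parity-∧ˡ true  f = refl
parity-∧ˡ {m} false f = parity-zero {m} {λ _ → false} (λ _ → refl)

parity-swap : ∀ {m m'} (F : Fin m → Fin m' → Bool) →
  parity (λ i → parity (F i)) ≡ parity (λ j → parity (λ i → F i j))
parity-swap {zero} {m'} F = sym (parity-zero {m'} {λ _ → false} (λ _ → refl))
parity-swap {suc m} F = trans (cong (parity (F fz) xor_) (parity-swap (F ∘ fs)))
  (sym (parity-xor (F fz) (λ j → parity (λ i → F (fs i) j))))

parity-single : ∀ {m} (f : Fin m → Bool) j → (∀ i → i ≢ j → f i ≡ false) → parity f ≡ f j
parity-single f fz     h = trans (cong (f fz xor_) (parity-zero (λ i → h (fs i) λ ()))) (Boolₚ.xor-identityʳ _)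
parity-single f (fs j) h = cong₂ _xor_ (h fz λ ())
  (parity-single (f ∘ fs) j (λ i i≢j → h (fs i) (i≢j ∘ Finₚ.suc-injective)))

parity-true : ∀ {m} (f : Fin m → Bool) → parity f ≡ true → ∃ λ i → f i ≡ true
parity-true {suc m} f h with f fz in eq
... | true  = fz , eq
... | false with parity-true (f ∘ fs) h
...   | i , p = fs i , p

module _ {m : ℕ} where

  δ : Fin m → Fin m → Bool
  δ a i = does (i ≟ a)

  δ-refl : ∀ a → δ a a ≡ true
  δ-refl a = dec-true (a ≟ a) refl

  δ-≢ : ∀ {a i} → i ≢ a → δ a i ≡ false
  δ-≢ {a} {i} = dec-false (i ≟ a)

  δ-true : ∀ {a i} → δ a i ≡ true → i ≡ a
  δ-true {a} {i} h with i ≟ a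
  ... | yes eq = eq
  δ-true {a} {i} () | no _

  opaque

    dot : (f g : Fin m → Bool) → Bool
    dot f g = parity (λ i → f i ∧ g i)

    dot-parity : ∀ f g → dot f g ≡ parity (λ i → f i ∧ g i)
    dot-parity f g = refl

    dot-cong : ∀ {f f' g g'} → (∀ i → f i ≡ f' i) → (∀ i → f i ≡ true → g i ≡ g' i) → dot f g ≡ dot f' g'
    dot-cong {f} {f'} {g} {g'} hf hg = parity-cong term
      where
      term : ∀ i → f i ∧ g i ≡ f' i ∧ g' i
      term i with f i in eq
      ... | true  rewrite sym (hf i) | eq = hg i eq
      ... | false rewrite sym (hf i) | eq = refl

    dot-zero : ∀ {f g} → (∀ i → f i ≡ true → g i ≡ false) → dot f g ≡ false
    dot-zero {f} {g} h = trans (dot-cong (λ _ → refl) h) (parity-zero (λ i → Boolₚ.∧-zeroʳ (f i)))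

    dot-comm : ∀ f g → dot f g ≡ dot g f
    dot-comm f g = parity-cong (λ i → Boolₚ.∧-comm (f i) (g i))

    dot-true : ∀ f g → dot f g ≡ true → ∃ λ i → f i ≡ true × g i ≡ true
    dot-true f g h with parity-true _ h
    ... | i , p = i , ∧-true p

    dot-xorʳ : ∀ f g h → dot f (λ i → g i xor h i) ≡ dot f g xor dot f h
    dot-xorʳ f g h = trans (parity-cong (λ i → Boolₚ.∧-distribˡ-xor (f i) (g i) (h i))) (parity-xor {m} _ _)

    dot-xorˡ : ∀ f g h → dot (λ i → f i xor g i) h ≡ dot f h xor dot g h
    dot-xorˡ f g h = trans (dot-comm (λ i → f i xor g i) h) (trans (dot-xorʳ h f g) (cong₂ _xor_ (dot-comm h f) (dot-comm h g)))

    dot-∧ˡ : ∀ b f g → dot (λ i → b ∧ f i) g ≡ b ∧ dot f g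
    dot-∧ˡ b f g = trans (parity-cong (λ i → Boolₚ.∧-assoc b (f i) (g i))) (parity-∧ˡ {m} b _)

    dot-∧ʳ : ∀ f g b → dot f (λ i → g i ∧ b) ≡ dot f g ∧ b
    dot-∧ʳ f g b = trans (dot-comm f (λ i → g i ∧ b)) (trans (parity-cong (λ i → cong (_∧ f i) (Boolₚ.∧-comm (g i) b)))
      (trans (dot-∧ˡ b g f) (trans (cong (b ∧_) (dot-comm g f)) (Boolₚ.∧-comm b (dot f g)))))

    dot-single : ∀ f g a → (∀ i → i ≢ a → f i ≡ true → g i ≡ false) → dot f g ≡ f a ∧ g a
    dot-single f g a h = parity-single _ a term
      where
      term : ∀ i → i ≢ a → f i ∧ g i ≡ false
      term i ne with f i in eq
      ... | true  = h i ne eq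
      ... | false = refl

    dot-δʳ : ∀ f a → dot f (δ a) ≡ f a
    dot-δʳ f a = trans (dot-single f (δ a) a (λ i ne _ → δ-≢ ne))
      (trans (cong (f a ∧_) (δ-refl a)) (Boolₚ.∧-identityʳ (f a)))

    dot-δˡ : ∀ f a → dot (δ a) f ≡ f a
    dot-δˡ f a = trans (dot-comm (δ a) f) (dot-δʳ f a)

opaque
  unfolding dot

  -- Exchanging the two sums gives associativity of the product of row vector, matrix and column
  -- vector.
  dot-assoc : ∀ {m m'} (f : Fin m → Bool) (N : Fin m → Fin m' → Bool) (g : Fin m' → Bool) →
    dot f (λ u → dot (N u) g) ≡ dot (λ w → dot f (λ u → N u w)) g
  dot-assoc {m} {m'} f N g = begin
    parity (λ u → f u ∧ parity (λ w → N u w ∧ g w))   ≡⟨ parity-cong (λ u → sym (parity-∧ˡ {m'} (f u) (λ w → N u w ∧ g w))) ⟩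
    parity (λ u → parity (λ w → f u ∧ (N u w ∧ g w))) ≡⟨ parity-cong (λ u → parity-cong (λ w → sym (Boolₚ.∧-assoc (f u) (N u w) (g w)))) ⟩
    parity (λ u → parity (λ w → (f u ∧ N u w) ∧ g w)) ≡⟨ parity-swap (λ u w → (f u ∧ N u w) ∧ g w) ⟩
    parity (λ w → parity (λ u → (f u ∧ N u w) ∧ g w)) ≡⟨ parity-cong (λ w → trans
        (parity-cong (λ u → Boolₚ.∧-comm (f u ∧ N u w) (g w)))
        (trans (parity-∧ˡ (g w) (λ u → f u ∧ N u w)) (Boolₚ.∧-comm (g w) _))) ⟩
    parity (λ w → parity (λ u → f u ∧ N u w) ∧ g w) ∎
    where open ≡-Reasoning

lookup-injective : {A : Set} {xs : List A} → Unique xs → ∀ i j → lookup xs i ≡ lookup xs j → i ≡ j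
lookup-injective (_ ∷ _)      fz     fz     _  = refl
lookup-injective (x∉ ∷ _)     fz     (fs j) eq = ⊥-elim (All.lookup x∉ (∈-lookup j) eq)
lookup-injective (x∉ ∷ _)     (fs i) fz     eq = ⊥-elim (All.lookup x∉ (∈-lookup i) (sym eq))
lookup-injective (_ ∷ unique) (fs i) (fs j) eq = cong fs (lookup-injective unique i j eq)

-- Cut rank and bases

module Cuts (G : Graph) where

  private
    _─_ : V G → V G → Bool
    _─_ = adj G

  Form : Set
  Form = V G → V G → Bool

  -- If N is the inverse of the A × B adjacency matrix, the sum is the entry at
  -- (x , y) predicted from the entries at (x , B) and (A , y); the residual
  -- vanishes on X × X̄ once A and B span the rows and columns of the cut.
  residual : Form → V G → V G → Bool
  residual N x y = (x ─ y) xor dot (x ─_) (λ u → dot (N u) (_─ y))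

  Supported : Form → List (V G) → List (V G) → Set
  Supported N B A = ∀ {u w} → N u w ≡ true → u ∈ B × w ∈ A

  Inside : VSet G → List (V G) → Set
  Inside X A = ∀ {x} → x ∈ A → X x ≡ true

  Outside : VSet G → List (V G) → Set
  Outside X B = ∀ {y} → y ∈ B → X y ≡ false

  Independent : VSet G → List (V G) → Set
  Independent X A = ∀ c → (∀ {v} → c v ≡ true → v ∈ A) →
    (∀ y → X y ≡ false → dot c (_─ y) ≡ false) → ∀ v → c v ≡ false

  Vanishes : VSet G → Form → V G → Set
  Vanishes X N x = ∀ y → X y ≡ false → residual N x y ≡ false

  -- The data pebbled at one node: `A` is a row basis of the cut and `B` spans its columns. The
  -- field `cut` is what forbids arcs leaving `X`.
  record Split (X : VSet G) (k : ℕ) : Set where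
    field
      A B         : List (V G)
      N           : Form
      inside      : Inside X A
      outside     : Outside X B
      unique      : Unique A
      independent : Independent X A
      |A|≤k       : length A ≤ k
      |B|≤k       : length B ≤ k
      supported   : Supported N B A
      cut         : ∀ x → X x ≡ true → Vanishes X N x

  -- `S` collects rows that must be kept and `Z` the columns that are allowed, so that a child can
  -- reuse pebbles of its parent and sibling.
  SplitBetween : VSet G → ℕ → List (V G) → List (V G) → Set
  SplitBetween X k S Z = Σ (Split X k) λ D → S ⊆ Split.A D × Split.B D ⊆ Z

  -- Associating the other way writes the residual row of `x` as its own row plus a combination of
  -- rows in the support of `N`; a vanishing residual is thus a linear dependence.
  residual-row : ∀ N x y → residual N x y ≡ (x ─ y) xor dot (λ w → dot (x ─_) (λ u → N u w)) (_─ y)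
  residual-row N x y = cong ((x ─ y) xor_) (dot-assoc (x ─_) N (_─ y))

  -- The first `suc k` entries of a longer `A` would be dependent by the cut rank bound.
  rank-bound : ∀ {X k A} → CutRank≤ G X k → Unique A → Inside X A → Independent X A → length A ≤ k
  rank-bound {X} {k} {A} rk uniq A⊆X indep with length A ℕₚ.≤? k
  ... | yes le = le
  ... | no  gt = ⊥-elim (true≢false (trans (sym c-hit) (indep c c⊆A c-annihilates (s i₀))))
    where
    k<A : suc k ≤ length A
    k<A = ℕₚ.≰⇒> gt
    s : Fin (suc k) → V G
    s i = lookup A (inject≤ i k<A)
    s-inj : Injective _≡_ _≡_ s
    s-inj {i} {j} eq = Finₚ.inject≤-injective k<A k<A i j (lookup-injective uniq _ _ eq)
    dep = rk s s-inj (λ i → A⊆X (∈-lookup (inject≤ i k<A)))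
    S = proj₁ dep
    i₀ = proj₁ (proj₁ (proj₂ dep))
    -- Transports the coefficients `S` from indices to vertices; as `s` is injective, `s i₀` keeps
    -- the coefficient `true`.
    c : VSet G
    c v = dot S (λ i → δ v (s i))
    c⊆A : ∀ {v} → c v ≡ true → v ∈ A
    c⊆A {v} h with dot-true S _ h
    ... | i , _ , p = subst (_∈ A) (δ-true p) (∈-lookup (inject≤ i k<A))
    c-annihilates : ∀ y → X y ≡ false → dot c (_─ y) ≡ false
    c-annihilates y y∉X = trans (sym (dot-assoc S (λ i v → δ v (s i)) (_─ y)))
      (trans (dot-cong {f = S} (λ _ → refl) (λ i _ → trans
        (dot-cong {f = λ v → δ v (s i)} {f' = δ (s i)} (λ v → δ-sym v (s i)) (λ _ _ → refl))
        (dot-δˡ (_─ y) (s i))))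
        (trans (dot-parity S _) (proj₂ (proj₂ dep) y y∉X)))
      where
      δ-sym : ∀ a b → δ a b ≡ δ b a
      δ-sym a b with b ≟ a
      ... | yes refl = sym (δ-refl a)
      ... | no ne = sym (δ-≢ (ne ∘ sym))
    c-hit : c (s i₀) ≡ true
    c-hit = trans (dot-single S _ i₀ (λ i ne _ → δ-≢ (ne ∘ s-inj)))
      (cong₂ _∧_ (proj₂ (proj₁ (proj₂ dep))) (δ-refl (s i₀)))

  -- Gaussian elimination: each pivot (x₀ , y₀) replaces the residual by its
  -- Schur complement, killing row x₀ and keeping the rows already killed.
  record Pivots (X : VSet G) (Z A : List (V G)) : Set where
    field
      B           : List (V G)
      N           : Form
      inside      : Inside X A
      unique      : Unique A
      independent : Independent X A
      B⊆Z         : B ⊆ Z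
      |B|≡|A|     : length B ≡ length A
      supported   : Supported N B A
      vanishes    : ∀ {x} → x ∈ A → Vanishes X N x

  module _ {X : VSet G} {Z : List (V G)} (Z∉X : Outside X Z) where

    pivot : ∀ {A} (P : Pivots X Z A) x₀ y₀ → X x₀ ≡ true → y₀ ∈ Z → residual (Pivots.N P) x₀ y₀ ≡ true →
      Σ (Pivots X Z (x₀ ∷ A)) λ P' → ∀ x → Vanishes X (Pivots.N P) x → Vanishes X (Pivots.N P') x
    pivot {A} P x₀ y₀ x₀∈X y₀∈Z e₀ = record
      { B = y₀ ∷ B
      ; N = N'
      ; inside = λ { (here refl) → x₀∈X ; (there m) → inside m }
      ; unique = ¬Any⇒All¬ A x₀∉A ∷ unique
      ; independent = independent'
      ; B⊆Z = λ { (here refl) → y₀∈Z ; (there m) → B⊆Z m }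
      ; |B|≡|A| = cong suc |B|≡|A|
      ; supported = supported'
      ; vanishes = λ { (here refl) → vanishes₀ ; (there m) → keeps _ (vanishes m) }
      } , keeps
      where
      open Pivots P
      q : VSet G
      q u = dot (N u) (_─ y₀)
      r : VSet G
      r w = dot (x₀ ─_) (λ u → N u w)
      -- These reproduce the residual column of `y₀` and the residual row of `x₀`, so adding their
      -- outer product to `N` yields the Schur complement. The pivot entry is 1, hence no division.
      Lc Rc : VSet G
      Lc u = δ y₀ u xor q u
      Rc w = δ x₀ w xor r w
      N' : Form
      N' u w = N u w xor (Lc u ∧ Rc w)
      col₀ : ∀ x → dot (x ─_) Lc ≡ residual N x y₀
      col₀ x = trans (dot-xorʳ (x ─_) (δ y₀) q) (cong (_xor dot (x ─_) q) (dot-δʳ (x ─_) y₀))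
      row₀ : ∀ y → dot Rc (_─ y) ≡ residual N x₀ y
      row₀ y = trans (dot-xorˡ (δ x₀) r (_─ y)) (trans (cong (_xor dot r (_─ y)) (dot-δˡ (_─ y) x₀))
        (sym (residual-row N x₀ y)))
      schur : ∀ x y → residual N' x y ≡ residual N x y xor (residual N x y₀ ∧ residual N x₀ y)
      schur x y = begin
        (x ─ y) xor dot (x ─_) (λ u → dot (N' u) (_─ y))
          ≡⟨ cong ((x ─ y) xor_) (dot-cong {f = x ─_} (λ _ → refl) (λ u _ →
               trans (dot-xorˡ (N u) (λ w → Lc u ∧ Rc w) (_─ y))
                 (cong (dot (N u) (_─ y) xor_) (dot-∧ˡ (Lc u) Rc (_─ y))))) ⟩
        (x ─ y) xor dot (x ─_) (λ u → dot (N u) (_─ y) xor (Lc u ∧ dot Rc (_─ y)))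
          ≡⟨ cong ((x ─ y) xor_) (trans (dot-xorʳ (x ─_) _ _) (cong (dot (x ─_) (λ u → dot (N u) (_─ y)) xor_)
               (dot-∧ʳ (x ─_) Lc (dot Rc (_─ y))))) ⟩
        (x ─ y) xor (dot (x ─_) (λ u → dot (N u) (_─ y)) xor (dot (x ─_) Lc ∧ dot Rc (_─ y)))
          ≡⟨ sym (Boolₚ.xor-assoc (x ─ y) _ _) ⟩
        residual N x y xor (dot (x ─_) Lc ∧ dot Rc (_─ y))
          ≡⟨ cong (residual N x y xor_) (cong₂ _∧_ (col₀ x) (row₀ y)) ⟩
        residual N x y xor (residual N x y₀ ∧ residual N x₀ y) ∎
        where open ≡-Reasoning
      y₀∉X : X y₀ ≡ false
      y₀∉X = Z∉X y₀∈Z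
      keeps : ∀ x → Vanishes X N x → Vanishes X N' x
      keeps x h y y∉X = trans (schur x y) (cong₂ _xor_ (h y y∉X) (cong (_∧ residual N x₀ y) (h y₀ y₀∉X)))
      vanishes₀ : Vanishes X N' x₀
      vanishes₀ y y∉X = trans (schur x₀ y) (trans (cong (λ b → residual N x₀ y xor (b ∧ residual N x₀ y)) e₀)
        (Boolₚ.xor-same (residual N x₀ y)))
      x₀∉A : ¬ (x₀ ∈ A)
      x₀∉A m = true≢false (trans (sym e₀) (vanishes m y₀ y₀∉X))
      supported' : Supported N' (y₀ ∷ B) (x₀ ∷ A)
      supported' {u} {w} h with xor-true {N u w} h
      ... | inj₁ p = there (proj₁ (supported p)) , there (proj₂ (supported p))
      ... | inj₂ p with ∧-true {Lc u} p
      ...   | pl , pr = left (xor-true {δ y₀ u} pl) , right (xor-true {δ x₀ w} pr)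
        where
        left : δ y₀ u ≡ true ⊎ q u ≡ true → u ∈ y₀ ∷ B
        left (inj₁ eq) = here (δ-true eq)
        left (inj₂ eq) = there (proj₁ (supported (proj₁ (proj₂ (dot-true (N u) _ eq)))))
        right : δ x₀ w ≡ true ⊎ r w ≡ true → w ∈ x₀ ∷ A
        right (inj₁ eq) = here (δ-true eq)
        right (inj₂ eq) = there (proj₂ (supported (proj₂ (proj₂ (dot-true (x₀ ─_) _ eq)))))
      independent' : Independent X (x₀ ∷ A)
      independent' c c⊆ ann = independent c c⊆A ann
        where
        -- Weighted by `c`, the residual column of `y₀` sums to zero, as `c` annihilates the columns
        -- of `y₀` and `B`. Rows of `A` contribute nothing to it, so the coefficient of `x₀` must
        -- vanish.
        sum : dot c (λ v → residual N v y₀) ≡ false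
        sum = trans (dot-xorʳ c (_─ y₀) _) (cong₂ _xor_ (ann y₀ y₀∉X)
          (trans (dot-assoc c (λ v u → v ─ u) q) (trans (dot-comm _ q) (dot-zero {f = q} λ u qu →
            ann u (Z∉X (B⊆Z (proj₁ (supported (proj₁ (proj₂ (dot-true (N u) _ qu)))))))))))
        cx₀ : c x₀ ≡ false
        cx₀ = trans (sym (Boolₚ.∧-identityʳ (c x₀))) (trans (cong (c x₀ ∧_) (sym e₀))
          (trans (sym (dot-single c (λ v → residual N v y₀) x₀ off)) sum))
          where
          off : ∀ v → v ≢ x₀ → c v ≡ true → residual N v y₀ ≡ false
          off v ne cv with c⊆ cv
          ... | here eq = ⊥-elim (ne eq)
          ... | there m = vanishes m y₀ y₀∉X
        c⊆A : ∀ {v} → c v ≡ true → v ∈ A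
        c⊆A {v} cv with c⊆ cv
        ... | here refl = ⊥-elim (true≢false (trans (sym cv) cx₀))
        ... | there m = m

    Spanning : Set
    Spanning = ∀ y → X y ≡ false → ∃ λ β → (∀ {u} → β u ≡ true → u ∈ Z) ×
      (∀ x → X x ≡ true → (x ─ y) ≡ dot (x ─_) β)

    module _ (span : Spanning) where

      -- The residual row of `x` is a combination of rows in `X`, hence respects the relations by
      -- which the columns in `Z` span all others.
      vanishes-on-Z : ∀ {A} (P : Pivots X Z A) x → X x ≡ true →
        (∀ {z} → z ∈ Z → residual (Pivots.N P) x z ≡ false) → Vanishes X (Pivots.N P) x
      vanishes-on-Z P x x∈X h y y∉X with span y y∉X
      ... | β , β⊆Z , sp = begin
        residual N x y ≡⟨ residual-row N x y ⟩
        (x ─ y) xor dot r (_─ y)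
          ≡⟨ cong₂ _xor_ (sp x x∈X) (dot-cong {f = r} (λ _ → refl) (λ w rw → sp w (r⊆X w rw))) ⟩
        dot (x ─_) β xor dot r (λ w → dot (w ─_) β)
          ≡⟨ cong (dot (x ─_) β xor_) (dot-assoc r _─_ β) ⟩
        dot (x ─_) β xor dot (λ u → dot r (_─ u)) β
          ≡⟨ sym (dot-xorˡ (x ─_) _ β) ⟩
        dot (λ u → (x ─ u) xor dot r (_─ u)) β
          ≡⟨ dot-comm _ β ⟩
        dot β (λ u → (x ─ u) xor dot r (_─ u))
          ≡⟨ dot-zero {f = β} (λ u βu → trans (sym (residual-row N x u)) (h (β⊆Z βu))) ⟩
        false ∎
        where
        open ≡-Reasoning
        open Pivots P
        r : VSet G
        r w = dot (x ─_) (λ u → N u w)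
        r⊆X : ∀ w → r w ≡ true → X w ≡ true
        r⊆X w rw = inside (proj₂ (supported (proj₂ (proj₂ (dot-true (x ─_) _ rw)))))

      pivot-or-vanish : ∀ {A} (P : Pivots X Z A) x → X x ≡ true →
        (∃ λ y → y ∈ Z × residual (Pivots.N P) x y ≡ true) ⊎ Vanishes X (Pivots.N P) x
      pivot-or-vanish P x x∈X with any? (λ z → residual (Pivots.N P) x z Boolₚ.≟ true) Z
      ... | yes a = inj₁ (find a)
      ... | no ¬a = inj₂ (vanishes-on-Z P x x∈X (λ m → ¬true⇒false (λ h → ¬a (lose m h))))

      -- Every row of `S` yields a pivot: a vanishing residual row of `s` would express it through
      -- the remaining rows, against independence.
      pivots-of : ∀ {S} → Unique S → Inside X S → Independent X S → Pivots X Z S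
      pivots-of {[]} _ _ _ = record
        { B = [] ; N = λ _ _ → false ; inside = λ () ; unique = []
        ; independent = λ c c⊆ _ v → ¬true⇒false (λ h → case∅ (c⊆ h))
        ; B⊆Z = λ () ; |B|≡|A| = refl ; supported = λ () ; vanishes = λ () }
        where
        case∅ : ∀ {v : V G} → ¬ (v ∈ [])
        case∅ ()
      pivots-of {s ∷ S} us@(_ ∷ uS) S⊆X indep
        with pivots-of uS (S⊆X ∘ there) (λ c c⊆ → indep c (there ∘ c⊆))
      ... | P with pivot-or-vanish P s (S⊆X (here refl))
      ...   | inj₁ (y , y∈Z , e) = proj₁ (pivot P s y (S⊆X (here refl)) y∈Z e)
      ...   | inj₂ van = ⊥-elim (true≢false (trans (sym cs) (indep c c⊆ ann s)))
        where
        open Pivots P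
        r c : VSet G
        r w = dot (s ─_) (λ u → N u w)
        c w = δ s w xor r w
        r⊆ : ∀ {w} → r w ≡ true → w ∈ S
        r⊆ rw = proj₂ (supported (proj₂ (proj₂ (dot-true (s ─_) _ rw))))
        c⊆ : ∀ {w} → c w ≡ true → w ∈ s ∷ S
        c⊆ {w} h with xor-true {δ s w} h
        ... | inj₁ p = here (δ-true p)
        ... | inj₂ p = there (r⊆ p)
        ann : ∀ y → X y ≡ false → dot c (_─ y) ≡ false
        ann y y∉X = trans (dot-xorˡ (δ s) r (_─ y)) (trans (cong (_xor dot r (_─ y)) (dot-δˡ (_─ y) s))
          (trans (sym (residual-row N s y)) (van y y∉X)))
        cs : c s ≡ true
        cs = cong₂ _xor_ (δ-refl s) (¬true⇒false (λ h → Uniqueₚ.Unique[x∷xs]⇒x∉xs us (r⊆ h)))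

      -- Each vertex of `M` in `X` either vanishes already or becomes a pivot, and later pivots keep
      -- it vanishing.
      exhaust : ∀ {A} (P : Pivots X Z A) M →
        ∃ λ A' → Σ (Pivots X Z A') λ P' → A ⊆ A' ×
          (∀ x → Vanishes X (Pivots.N P) x → Vanishes X (Pivots.N P') x) ×
          (∀ {x} → x ∈ M → X x ≡ true → Vanishes X (Pivots.N P') x)
      exhaust P [] = _ , P , (λ m → m) , (λ _ h → h) , λ ()
      exhaust P (x ∷ M) with X x in x∈X
      ... | false with exhaust P M
      ...   | A' , P' , A⊆ , keep , done = A' , P' , A⊆ , keep ,
              λ { (here refl) h → ⊥-elim (true≢false (trans (sym h) x∈X)) ; (there m) h → done m h }
      exhaust P (x ∷ M) | true with pivot-or-vanish P x x∈X
      ... | inj₂ van with exhaust P M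
      ...   | A' , P' , A⊆ , keep , done = A' , P' , A⊆ , keep ,
              λ { (here refl) _ → keep _ van ; (there m) h → done m h }
      exhaust P (x ∷ M) | true | inj₁ (y , y∈Z , e) with pivot P x y x∈X y∈Z e
      ... | P₁ , keep₁ with exhaust P₁ M
      ...   | A' , P' , A⊆ , keep , done = A' , P' , A⊆ ∘ there , (λ x h → keep x (keep₁ x h)) ,
              λ { (here refl) _ → keep _ (Pivots.vanishes P₁ (here refl)) ; (there m) h → done m h }

      opaque
        split : ∀ {k S} → CutRank≤ G X k → Unique S → Inside X S → Independent X S → SplitBetween X k S Z
        split {k} rk uS S⊆X indep with exhaust (pivots-of uS S⊆X indep) (allFin (n G))
        ... | A' , P , S⊆A , _ , done = record
          { A = A' ; B = B ; N = N ; inside = inside ; outside = Z∉X ∘ B⊆Z ; unique = unique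
          ; independent = independent
          ; |A|≤k = bound
          ; |B|≤k = subst (_≤ k) (sym |B|≡|A|) bound
          ; supported = supported
          ; cut = λ x → done (∈-allFin x) } , S⊆A , B⊆Z
          where
          open Pivots P
          bound : length A' ≤ k
          bound = rank-bound rk unique inside independent

  -- Rows of X ∖ Xᵢ are spanned by A′, columns outside X by B.
  spanning-sibling : ∀ {k} {X Xᵢ Xⱼ : VSet G} (D : Split X k) (D' : Split Xⱼ k) →
    (∀ x → X x ≡ (Xᵢ x ∨ Xⱼ x)) → (∀ x → (Xᵢ x ∧ Xⱼ x) ≡ false) →
    ∀ y → Xᵢ y ≡ false → ∃ λ β → (∀ {u} → β u ≡ true → u ∈ Split.A D' ++ Split.B D) ×
      (∀ x → Xᵢ x ≡ true → (x ─ y) ≡ dot (x ─_) β)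
  spanning-sibling {k} {X} {Xᵢ} {Xⱼ} D D' union disj y y∉ with Xⱼ y in eq
  ... | true = β , (λ h → ∈-++⁺ˡ (proj₂ (D'.supported (proj₂ (proj₂ (dot-true (y ─_) _ h)))))) ,
        λ x x∈ → trans (adj-sym G x y) (trans
          (xor-cancel (trans (sym (residual-row D'.N y x)) (D'.cut y eq x (off x x∈))))
          (trans (dot-comm β (_─ x)) (dot-cong {g = β} (λ u → adj-sym G u x) (λ _ _ → refl))))
    where
    module D' = Split D'
    β : VSet G
    β w = dot (y ─_) (λ u → D'.N u w)
    off : ∀ x → Xᵢ x ≡ true → Xⱼ x ≡ false
    off x x∈ = trans (sym (cong (_∧ Xⱼ x) x∈)) (disj x)
  ... | false = β , (λ h → ∈-++⁺ʳ (Split.A D') (proj₁ (D.supported (proj₁ (proj₂ (dot-true (D.N _) _ h)))))) ,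
        λ x x∈ → xor-cancel (D.cut x (trans (union x) (cong (_∨ Xⱼ x) x∈)) y
          (trans (union y) (cong₂ _∨_ y∉ eq)))
    where
    module D = Split D
    β : VSet G
    β u = dot (D.N u) (_─ y)

  record ChildSplits {X : VSet G} {k : ℕ} (D : Split X k) (X₁ X₂ : VSet G) : Set where
    field
      D₁ : Split X₁ k
      D₂ : Split X₂ k
      A⊆ : Split.A D ⊆ Split.A D₁ ++ Split.A D₂
      B₁⊆ : Split.B D₁ ⊆ Split.A D₂ ++ Split.B D
      B₂⊆ : Split.B D₂ ⊆ Split.A D₁ ++ Split.B D

  opaque
    -- The columns of each child come from the rows of its sibling, which looks circular. So first
    -- settle rows for `X₁` with all columns allowed, then split `X₂` using these rows and `D.B`,
    -- then split `X₁` again over the rows of `X₂`. The rows of `X₁` only grow, so the columns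
    -- chosen for `X₂` stay legitimate.
    child-splits : ∀ {X k} (D : Split X k) X₁ X₂ → (∀ x → X x ≡ (X₁ x ∨ X₂ x)) → (∀ x → (X₁ x ∧ X₂ x) ≡ false) →
      CutRank≤ G X₁ k → CutRank≤ G X₂ k → ChildSplits D X₁ X₂
    child-splits {X} {k} D X₁ X₂ union disj rk₁ rk₂ = record
      { D₁ = proj₁ s₃ ; D₂ = proj₁ s₂
      ; A⊆ = A⊆
      ; B₁⊆ = proj₂ (proj₂ s₃)
      ; B₂⊆ = λ m → grow (proj₂ (proj₂ s₂) m) }
      where
      module D = Split D
      union' : ∀ x → X x ≡ (X₂ x ∨ X₁ x)
      union' x = trans (union x) (Boolₚ.∨-comm (X₁ x) (X₂ x))
      disj' : ∀ x → (X₂ x ∧ X₁ x) ≡ false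
      disj' x = trans (Boolₚ.∧-comm (X₂ x) (X₁ x)) (disj x)
      ⊆X₁ : ∀ {x} → X x ≡ false → X₁ x ≡ false
      ⊆X₁ {x} h with X₁ x in eq
      ... | false = refl
      ... | true  = trans (sym (trans (union x) (cong (_∨ X₂ x) eq))) h
      ⊆X₂ : ∀ {x} → X x ≡ false → X₂ x ≡ false
      ⊆X₂ {x} h with X₂ x in eq
      ... | false = refl
      ... | true  = trans (sym (trans (union' x) (cong (_∨ X₁ x) eq))) h
      disjoint : ∀ {x} → X₁ x ≡ true → X₂ x ≡ false
      disjoint {x} h = trans (sym (cong (_∧ X₂ x) h)) (disj x)
      disjoint' : ∀ {x} → X₂ x ≡ true → X₁ x ≡ false
      disjoint' {x} h = trans (sym (cong (_∧ X₁ x) h)) (disj' x)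
      part : VSet G → List (V G)
      part Y = filter (λ x → Y x Boolₚ.≟ true) D.A
      -- Passing from `X` to the smaller `Y` adds columns, so annihilating all columns outside `Y`
      -- is the stronger assumption.
      part-independent : ∀ {Y} → (∀ {x} → X x ≡ false → Y x ≡ false) → Independent Y (part Y)
      part-independent {Y} h c c⊆ ann = D.independent c
        (λ cv → proj₁ (∈-filter⁻ (λ x → Y x Boolₚ.≟ true) (c⊆ cv))) (λ y y∉ → ann y (h y∉))
      part-inside : ∀ {Y} → Inside Y (part Y)
      part-inside {Y} m = proj₂ (∈-filter⁻ (λ x → Y x Boolₚ.≟ true) {xs = D.A} m)
      part-unique : ∀ {Y} → Unique (part Y)
      part-unique {Y} = Uniqueₚ.filter⁺ (λ x → Y x Boolₚ.≟ true) D.unique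
      co : List (V G)
      co = filter (λ y → X₁ y Boolₚ.≟ false) (allFin (n G))
      s₁ : SplitBetween X₁ k (part X₁) co
      s₁ = split {X₁} {co} (λ m → proj₂ (∈-filter⁻ (λ y → X₁ y Boolₚ.≟ false) {xs = allFin (n G)} m))
        (λ y y∉ → δ y , (λ h → ∈-filter⁺ (λ y → X₁ y Boolₚ.≟ false) (∈-allFin _) (subst (λ z → X₁ z ≡ false) (sym (δ-true h)) y∉)) ,
          λ x _ → sym (dot-δʳ (x ─_) y))
        rk₁ part-unique part-inside (part-independent ⊆X₁)
      outside₂ : Outside X₂ (Split.A (proj₁ s₁) ++ D.B)
      outside₂ m with ∈-++⁻ (Split.A (proj₁ s₁)) m
      ... | inj₁ p = disjoint (Split.inside (proj₁ s₁) p)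
      ... | inj₂ p = ⊆X₂ (D.outside p)
      s₂ : SplitBetween X₂ k (part X₂) (Split.A (proj₁ s₁) ++ D.B)
      s₂ = split {X₂} outside₂ (spanning-sibling D (proj₁ s₁) union' disj')
        rk₂ part-unique part-inside (part-independent ⊆X₂)
      outside₁ : Outside X₁ (Split.A (proj₁ s₂) ++ D.B)
      outside₁ m with ∈-++⁻ (Split.A (proj₁ s₂)) m
      ... | inj₁ p = disjoint' (Split.inside (proj₁ s₂) p)
      ... | inj₂ p = ⊆X₁ (D.outside p)
      s₃ : SplitBetween X₁ k (Split.A (proj₁ s₁)) (Split.A (proj₁ s₂) ++ D.B)
      s₃ = split {X₁} outside₁ (spanning-sibling D (proj₁ s₂) union disj)
        rk₁ (Split.unique (proj₁ s₁)) (Split.inside (proj₁ s₁)) (Split.independent (proj₁ s₁))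
      grow : ∀ {x} → x ∈ Split.A (proj₁ s₁) ++ D.B → x ∈ Split.A (proj₁ s₃) ++ D.B
      grow m with ∈-++⁻ (Split.A (proj₁ s₁)) m
      ... | inj₁ p = ∈-++⁺ˡ (proj₁ (proj₂ s₃) p)
      ... | inj₂ p = ∈-++⁺ʳ (Split.A (proj₁ s₃)) p
      A⊆ : D.A ⊆ Split.A (proj₁ s₃) ++ Split.A (proj₁ s₂)
      A⊆ {x} m with X₁ x in eq₁ | X₂ x in eq₂
      ... | true  | _     = ∈-++⁺ˡ (proj₁ (proj₂ s₃) (proj₁ (proj₂ s₁) (∈-filter⁺ (λ x → X₁ x Boolₚ.≟ true) m eq₁)))
      ... | false | true  = ∈-++⁺ʳ (Split.A (proj₁ s₃)) (proj₁ (proj₂ s₂) (∈-filter⁺ (λ x → X₂ x Boolₚ.≟ true) m eq₂))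
      ... | false | false = ⊥-elim (true≢false (trans (sym (D.inside m)) (trans (union x) (cong₂ _∨_ eq₁ eq₂))))

-- Gluing isomorphisms between classes

-- The maps are total but constrained only on `P` and `P'`, which lets them be combined by case
-- distinction.
record PartialIso (K H : Graph) (P : V K → Set) (P' : V H → Set) (Col : V K → V H → Set) : Set where
  field
    to      : V K → V H
    from    : V H → V K
    to-in   : ∀ {x} → P x → P' (to x)
    from-in : ∀ {x} → P' x → P (from x)
    from-to : ∀ {x} → P x → from (to x) ≡ x
    to-from : ∀ {x} → P' x → to (from x) ≡ x
    adj-to  : ∀ {x y} → P x → P y → adj K x y ≡ adj H (to x) (to y)
    col-to  : ∀ {x} → P x → Col x (to x)

-- `Col` behaves like equality of colours across two sets (`Col-dif`), and `π` makes corresponding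
-- colour classes equally large. By `cross`, matching colours suffice between different pieces.
record Pieces (K H : Graph) : Set₁ where
  field
    U       : V K → Set
    U'      : V H → Set
    _∼_     : V K → V K → Set
    _∼'_    : V H → V H → Set
    Col     : V K → V H → Set
    U?      : ∀ x → Dec (U x)
    U'?     : ∀ x → Dec (U' x)
    _∼?_    : ∀ x y → Dec (x ∼ y)
    _∼'?_   : ∀ x y → Dec (x ∼' y)
    Col?    : ∀ x y → Dec (Col x y)
    ∼-refl   : ∀ {x} → U x → x ∼ x
    ∼-sym    : ∀ {x y} → x ∼ y → y ∼ x
    ∼-trans  : ∀ {x y z} → x ∼ y → y ∼ z → x ∼ z
    ∼-U      : ∀ {x y} → x ∼ y → U x → U y
    ∼'-sym   : ∀ {x y} → x ∼' y → y ∼' x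
    ∼'-trans : ∀ {x y z} → x ∼' y → y ∼' z → x ∼' z
    Col-U   : ∀ {x y} → Col x y → U x → U' y
    Col-U'  : ∀ {x y} → Col x y → U' y → U x
    Col-dif : ∀ {x y z w} → Col x y → Col z y → Col z w → Col x w
    π       : V K ↔ V H
    Col-π   : ∀ x → Col x (Inverse.to π x)
    piece   : ∀ {x y} → U x → Col x y → Σ (PartialIso K H (x ∼_) (y ∼'_) Col) λ φ → PartialIso.to φ x ≡ y
    cross   : ∀ {x y z w} → U x → U z → Col x y → Col z w → ¬ (x ∼ z) → ¬ (y ∼' w) → adj K x z ≡ adj H y w

module Glue {K H : Graph} (D : Pieces K H) where

  open Pieces D
  open PartialIso

  record State : Set where
    field
      Y   : V K → Bool
      Y'  : V H → Bool
      iso : PartialIso K H (λ x → Y x ≡ true) (λ y → Y' y ≡ true) Col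
      Y⊆U : ∀ {x} → Y x ≡ true → U x
      saturated  : ∀ {x y} → Y x ≡ true → x ∼ y → Y y ≡ true
      saturated' : ∀ {x y} → Y' x ≡ true → x ∼' y → Y' y ≡ true

  open State

  empty : (V K → V H) → (V H → V K) → State
  empty f g = record
    { Y = λ _ → false ; Y' = λ _ → false
    ; iso = record { to = f ; from = g ; to-in = λ () ; from-in = λ () ; from-to = λ () ; to-from = λ ()
                   ; adj-to = λ () ; col-to = λ () }
    ; Y⊆U = λ () ; saturated = λ () ; saturated' = λ () }

  _⊑_ : State → State → Set
  s ⊑ t = ∀ x → Y s x ≡ true → Y t x ≡ true × to (iso t) x ≡ to (iso s) x

  -- Use the new piece on the class of `w` and the old isomorphism elsewhere. Saturation keeps
  -- domains and images disjoint, and `cross` settles mixed pairs.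
  extend : (s : State) → ∀ w w' → U w → Col w w' → Y s w ≡ false → Y' s w' ≡ false →
    Σ State λ t → (s ⊑ t) × (Y t w ≡ true) × (to (iso t) w ≡ w')
  extend s w w' Uw Cw new new' = t , ⊑t , covered , pointed
    where
    φ = proj₁ (piece Uw Cw)
    ψ = iso s
    Y₁ : V K → Bool
    Y₁ x with w ∼? x
    ... | yes _ = true
    ... | no _  = Y s x
    Y₁' : V H → Bool
    Y₁' y with w' ∼'? y
    ... | yes _ = true
    ... | no _  = Y' s y
    f : V K → V H
    f x with w ∼? x
    ... | yes _ = to φ x
    ... | no _  = to ψ x
    g : V H → V K
    g y with w' ∼'? y
    ... | yes _ = from φ y
    ... | no _  = from ψ y
    apart : ∀ {x} → w ∼ x → Y s x ≡ true → ⊥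
    apart wx yx = true≢false (trans (sym (saturated s yx (∼-sym wx))) new)
    apart' : ∀ {y} → w' ∼' y → Y' s y ≡ true → ⊥
    apart' wy yy = true≢false (trans (sym (saturated' s yy (∼'-sym wy))) new')
    f-in : ∀ {x} → Y₁ x ≡ true → Y₁' (f x) ≡ true
    f-in {x} h with w ∼? x
    f-in {x} h | yes wx with w' ∼'? to φ x
    ... | yes _ = refl
    ... | no ne = ⊥-elim (ne (to-in φ wx))
    f-in {x} h | no _ with w' ∼'? to ψ x
    ... | yes _ = refl
    ... | no _  = to-in ψ h
    g-in : ∀ {y} → Y₁' y ≡ true → Y₁ (g y) ≡ true
    g-in {y} h with w' ∼'? y
    g-in {y} h | yes wy with w ∼? from φ y
    ... | yes _ = refl
    ... | no ne = ⊥-elim (ne (from-in φ wy))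
    g-in {y} h | no _ with w ∼? from ψ y
    ... | yes _ = refl
    ... | no _  = from-in ψ h
    g-f : ∀ {x} → Y₁ x ≡ true → g (f x) ≡ x
    g-f {x} h with w ∼? x
    g-f {x} h | yes wx with w' ∼'? to φ x
    ... | yes _ = from-to φ wx
    ... | no ne = ⊥-elim (ne (to-in φ wx))
    g-f {x} h | no _ with w' ∼'? to ψ x
    ... | yes wy = ⊥-elim (apart' wy (to-in ψ h))
    ... | no _  = from-to ψ h
    f-g : ∀ {y} → Y₁' y ≡ true → f (g y) ≡ y
    f-g {y} h with w' ∼'? y
    f-g {y} h | yes wy with w ∼? from φ y
    ... | yes _ = to-from φ wy
    ... | no ne = ⊥-elim (ne (from-in φ wy))
    f-g {y} h | no _ with w ∼? from ψ y
    ... | yes wx = ⊥-elim (apart wx (from-in ψ h))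
    ... | no _  = to-from ψ h
    between : ∀ {x y} → w ∼ x → ¬ (w ∼ y) → Y s y ≡ true → adj K x y ≡ adj H (to φ x) (to ψ y)
    between wx ¬wy yy = cross (∼-U wx Uw) (Y⊆U s yy) (col-to φ wx) (col-to ψ yy)
      (λ xy → ¬wy (∼-trans wx xy)) (λ xy → apart' (∼'-trans (to-in φ wx) xy) (to-in ψ yy))
    f-adj : ∀ {x y} → Y₁ x ≡ true → Y₁ y ≡ true → adj K x y ≡ adj H (f x) (f y)
    f-adj {x} {y} hx hy with w ∼? x | w ∼? y
    ... | yes wx | yes wy = adj-to φ wx wy
    ... | yes wx | no ¬wy = between wx ¬wy hy
    ... | no ¬wx | yes wy = trans (adj-sym K x y) (trans (between wy ¬wx hx) (adj-sym H (to φ y) (to ψ x)))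
    ... | no _   | no _   = adj-to ψ hx hy
    f-col : ∀ {x} → Y₁ x ≡ true → Col x (f x)
    f-col {x} h with w ∼? x
    ... | yes wx = col-to φ wx
    ... | no _   = col-to ψ h
    Y₁⊆U : ∀ {x} → Y₁ x ≡ true → U x
    Y₁⊆U {x} h with w ∼? x
    ... | yes wx = ∼-U wx Uw
    ... | no _   = Y⊆U s h
    sat : ∀ {x y} → Y₁ x ≡ true → x ∼ y → Y₁ y ≡ true
    sat {x} {y} h xy with w ∼? x | w ∼? y
    ... | _      | yes _  = refl
    ... | yes wx | no ¬wy = ⊥-elim (¬wy (∼-trans wx xy))
    ... | no _   | no _   = saturated s h xy
    sat' : ∀ {x y} → Y₁' x ≡ true → x ∼' y → Y₁' y ≡ true
    sat' {x} {y} h xy with w' ∼'? x | w' ∼'? y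
    ... | _      | yes _  = refl
    ... | yes wx | no ¬wy = ⊥-elim (¬wy (∼'-trans wx xy))
    ... | no _   | no _   = saturated' s h xy
    t : State
    t = record { Y = Y₁ ; Y' = Y₁'
      ; iso = record { to = f ; from = g ; to-in = f-in ; from-in = g-in ; from-to = g-f ; to-from = f-g
                     ; adj-to = f-adj ; col-to = f-col }
      ; Y⊆U = Y₁⊆U ; saturated = sat ; saturated' = sat' }
    ⊑t : s ⊑ t
    ⊑t x yx with w ∼? x
    ... | yes wx = ⊥-elim (apart wx yx)
    ... | no _   = yx , refl
    covered : Y₁ w ≡ true
    covered with w ∼? w
    ... | yes _ = refl
    ... | no ne = ⊥-elim (ne (∼-refl Uw))
    pointed : f w ≡ w'
    pointed with w ∼? w
    ... | yes _ = proj₂ (piece Uw Cw)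
    ... | no ne = ⊥-elim (ne (∼-refl Uw))

  -- If all vertices coloured like w were covered, the map x ↦ ψ⁻¹ (π x)
  -- would inject the colour class of w into itself and miss w.
  uncovered : (s : State) → ∀ w → Y s w ≡ false → ∃ λ w' → Col w w' × Y' s w' ≡ false
  uncovered s w new with Finₚ.any? (λ w' → Col? w w' ×-dec (Y' s w' Boolₚ.≟ false))
  ... | yes found = found
  ... | no none = ⊥-elim (injectiveOn⇒surjectiveOn {P = P} (λ x → Col? x (Inverse.to π w)) f pres
          (λ x y px py eq → to-injective π (trans (sym (to-from (iso s) (hit px)))
            (trans (cong (to (iso s)) eq) (to-from (iso s) (hit py)))))
          w (Col-π w)
          (λ z pz eq → true≢false (trans (sym (from-in (iso s) (hit pz))) (trans (cong (Y s) eq) new))))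
    where
    P : V K → Set
    P x = Col x (Inverse.to π w)
    f : V K → V K
    f x = from (iso s) (Inverse.to π x)
    hit : ∀ {x} → P x → Y' s (Inverse.to π x) ≡ true
    hit {x} px with Y' s (Inverse.to π x) in eq
    ... | true  = refl
    ... | false = ⊥-elim (none (_ , Col-dif (Col-π w) px (Col-π x) , eq))
    pres : ∀ x → P x → P (f x)
    pres x px = Col-dif (subst (Col (f x)) (to-from (iso s) (hit px)) (col-to (iso s) (from-in (iso s) (hit px))))
      (Col-π x) px

  exhaust : (s : State) → ∀ M → Σ State λ t → (s ⊑ t) × (∀ {x} → x ∈ M → U x → Y t x ≡ true)
  exhaust s [] = s , (λ x yx → yx , refl) , λ ()
  exhaust s (x ∷ M) with U? x | Y s x in eq
  ... | no ¬Ux | _ with exhaust s M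
  ...   | t , s⊑t , done = t , s⊑t , λ { (here refl) Ux → ⊥-elim (¬Ux Ux) ; (there m) → done m }
  exhaust s (x ∷ M) | yes Ux | true with exhaust s M
  ...   | t , s⊑t , done = t , s⊑t , λ { (here refl) _ → proj₁ (s⊑t x eq) ; (there m) → done m }
  exhaust s (x ∷ M) | yes Ux | false with uncovered s x eq
  ...   | w' , Cw , new' with extend s x w' Ux Cw eq new'
  ...     | s₁ , s⊑s₁ , yx , _ with exhaust s₁ M
  ...       | t , s₁⊑t , done = t ,
      (λ z yz → proj₁ (s₁⊑t z (proj₁ (s⊑s₁ z yz))) ,
        trans (proj₂ (s₁⊑t z (proj₁ (s⊑s₁ z yz)))) (proj₂ (s⊑s₁ z yz))) ,
      λ { (here refl) _ → proj₁ (s₁⊑t x yx) ; (there m) → done m }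

  glue : ∀ v v' → U v → Col v v' → Σ (PartialIso K H U U' Col) λ φ → to φ v ≡ v'
  -- Placing `v` first pins its image, which later extensions never change. The constant maps are
  -- placeholders on an empty domain.
  glue v v' Uv Cv with extend (empty (λ _ → v') (λ _ → v)) v v' Uv Cv refl refl
  ... | s , _ , yv , pv with exhaust s (allFin (n K))
  ...   | t , s⊑t , done = record
      { to = to φ ; from = from φ
      ; to-in = λ u → Col-U (col-to φ (all u)) u
      ; from-in = λ u → Y⊆U t (from-in φ (all' u))
      ; from-to = λ u → from-to φ (all u)
      ; to-from = λ u → to-from φ (all' u)
      ; adj-to = λ u u' → adj-to φ (all u) (all u')
      ; col-to = λ u → col-to φ (all u)
      } , trans (proj₂ (s⊑t v yv)) pv
    where
    φ = iso t
    all : ∀ {x} → U x → Y t x ≡ true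
    all {x} = done (∈-allFin x)
    π⁻ : V H → V K
    π⁻ = Inverse.from π
    Col-π⁻ : ∀ y → Col (π⁻ y) y
    Col-π⁻ y = subst (Col (π⁻ y)) (Inverse.strictlyInverseˡ π y) (Col-π (π⁻ y))
    back : ∀ {y} → U' y → U (π⁻ y)
    back {y} u = Col-U' (Col-π⁻ y) u
    all' : ∀ {y} → U' y → Y' t y ≡ true
    all' {y} u with Y' t y in eq
    ... | true  = refl
    -- Surjectivity by counting: `φ` after `π⁻` injects `U'` into itself, so it cannot miss `y`.
    ... | false = ⊥-elim (injectiveOn⇒surjectiveOn U'? (λ z → to φ (π⁻ z))
        (λ z uz → Col-U (col-to φ (all (back uz))) (back uz))
        (λ x z ux uz e → to-injective (↔-sym π) (trans (sym (from-to φ (all (back ux))))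
          (trans (cong (from φ) e) (from-to φ (all (back uz))))))
        y u
        (λ z uz e → true≢false (trans (sym (to-in φ (all (back uz)))) (trans (cong (Y' t) e) eq))))

-- Supports, pebble lists and the pebble game

bilinear-cong : ∀ {m} {N : Fin m → Fin m → Bool} {f f' g g' : Fin m → Bool} →
  (∀ {u w} → N u w ≡ true → f u ≡ f' u × g w ≡ g' w) →
  dot f (λ u → dot (N u) g) ≡ dot f' (λ u → dot (N u) g')
bilinear-cong {N = N} {f} {f'} {g} {g'} h = trans (dot-comm f _) (trans
  (dot-cong inner (λ u t → proj₁ (h (proj₁ (proj₂ (dot-true (N u) g t))))))
  (dot-comm _ f'))
  where
  inner : ∀ u → dot (N u) g ≡ dot (N u) g'
  inner u = dot-cong (λ _ → refl) (λ w t → proj₂ (h t))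

swap-⊆ : {A : Set} {x y : A} {zs : List A} → (x ∷ y ∷ []) ⊆ (y ∷ x ∷ zs)
swap-⊆ (here eq)         = there (here eq)
swap-⊆ (there (here eq)) = here eq

head-⊆ : {A : Set} {x : A} {ys : List A} → (x ∷ []) ⊆ (x ∷ ys)
head-⊆ (here eq) = here eq

nth : {A : Set} → A → List A → ℕ → A
nth d []       _       = d
nth d (x ∷ xs) zero    = x
nth d (x ∷ xs) (suc i) = nth d xs i

nth-∈ : {A : Set} {d : A} {ys : List A} → d ∈ ys → ∀ xs → xs ⊆ ys → ∀ i → nth d xs i ∈ ys
nth-∈ d∈ []       _  _       = d∈
nth-∈ d∈ (x ∷ xs) h  zero    = h (here refl)
nth-∈ d∈ (x ∷ xs) h  (suc i) = nth-∈ d∈ xs (h ∘ there) i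

position : {A : Set} {d x : A} {xs : List A} → x ∈ xs → ∃ λ i → i < length xs × nth d xs i ≡ x
position (here refl) = 0 , s≤s z≤n , refl
position (there m) with position m
... | i , i< , eq = suc i , s≤s i< , eq

-- Serves the position without pebbles: a tuple must still have entries, and a pair of equal colour
-- supplies them.
Realised : ℕ → ℕ → Graph → Graph → Set
Realised ℓ i K L = Σ (Tuple ℓ K) λ u → Σ (Tuple ℓ L) λ v → SameColour ℓ i K L u v

-- The side true of Gr is the graph of small rank width, the side `false`
-- the graph it is compared with. Pebbled vertices of either side are indexed
-- by a list L of vertices of the first graph through a map ρ.
module Game (m N₀ : ℕ) (Gr : Bool → Graph)
  (stable : (a b : Bool) → Stable (suc (suc m)) N₀ (Gr a) (Gr b))
  (realised : (a b : Bool) → Realised (suc (suc m)) N₀ (Gr a) (Gr b)) where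

  ℓ : ℕ
  ℓ = suc (suc m)

  G : Graph
  G = Gr true

  open Cuts G using (Form; Supported)

  Vx : Bool → Set
  Vx a = V (Gr a)

  pebbles : ∀ a b → (V G → Vx a) → (V G → Vx b) → List (V G) → List (Vx a × Vx b)
  pebbles a b ρ ρ' L = map (λ t → ρ t , ρ' t) L

  -- Duplicator survives from the position consisting of the pebble pairs on L
  -- and the pairs xs.
  record W (a b : Bool) (ρ : V G → Vx a) (ρ' : V G → Vx b) (L : List (V G)) (xs : List (Vx a × Vx b)) : Set where
    constructor mkW
    field
      play : ∀ u v → (∀ i → (u i , v i) ∈ xs ++ pebbles a b ρ ρ' L) → SameColour ℓ N₀ (Gr a) (Gr b) u v

  open W

  private
    pattern at₀ = here refl
    pattern at₁ = there (here refl)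
    pattern at₂ = there (there (here refl))

  W-mono : ∀ {a b ρ σ σ' L L' xs ys} → (∀ {p} → p ∈ ys ++ pebbles a b ρ σ' L' → p ∈ xs ++ pebbles a b ρ σ L) →
    W a b ρ σ L xs → W a b ρ σ' L' ys
  W-mono h (mkW p) = mkW λ u v mem → p u v (λ i → h (mem i))

  module _ {a b : Bool} {ρ : V G → Vx a} {ρ' : V G → Vx b} where

    pebble : ∀ {L} xs {t} → t ∈ L → (ρ t , ρ' t) ∈ xs ++ pebbles a b ρ ρ' L
    pebble xs t∈L = ∈-++⁺ʳ xs (∈-map⁺ _ t∈L)

    W-weaken : ∀ {L L' xs ys} → L ⊆ L' → xs ⊆ ys → W a b ρ ρ' L' ys → W a b ρ ρ' L xs
    W-weaken L⊆ xs⊆ = W-mono (⊆ₚ.++⁺ xs⊆ (⊆ₚ.map⁺ _ L⊆))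

    -- Play the tuple with first entry `x` and all others `y`; its colour refines its atomic type.
    W-pair : ∀ {L xs x x' y y'} → W a b ρ ρ' L xs →
      (x , x') ∈ xs ++ pebbles a b ρ ρ' L → (y , y') ∈ xs ++ pebbles a b ρ ρ' L →
      (col (Gr a) x ≡ col (Gr b) x') × ((x ≡ y → x' ≡ y') × (x' ≡ y' → x ≡ y)) ×
      (adj (Gr a) x y ≡ adj (Gr b) x' y')
    W-pair {x = x} {x'} {y} {y'} (mkW p) mx my =
      atp N₀ (p u v (λ { fz → mx ; (fs _) → my })) fz (fs fz)
      where
      u : Tuple ℓ (Gr a)
      u fz     = x
      u (fs _) = y
      v : Tuple ℓ (Gr b)
      v fz     = x'
      v (fs _) = y'
      atp : ∀ i → SameColour ℓ i (Gr a) (Gr b) u v → AtpEq (Gr a) (Gr b) u v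
      atp zero    c = c
      atp (suc i) c = atp i (proj₁ c)

    W-sym : ∀ {L xs} → W a b ρ ρ' L xs → W b a ρ' ρ L (map swap xs)
    W-sym {L} {xs} (mkW p) = mkW λ u v h → sameColour-sym N₀ (p v u (λ i → flip (h i)))
      where
      flip : ∀ {y x} → (y , x) ∈ map swap xs ++ pebbles b a ρ' ρ L → (x , y) ∈ xs ++ pebbles a b ρ ρ' L
      flip q with ∈-++⁻ (map swap xs) q
      ... | inj₁ q₁ with ∈-map⁻ swap q₁
      ...   | _ , q₂ , refl = ∈-++⁺ˡ q₂
      flip q | inj₂ q₁ with ∈-map⁻ _ q₁
      ...   | _ , t∈L , refl = pebble xs t∈L

    module _ {L : List (V G)} {xs : List (Vx a × Vx b)} (w : W a b ρ ρ' L xs)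
             (small : length xs + length L ≤ suc m) where

      private
        ps : List (Vx a × Vx b)
        ps = xs ++ pebbles a b ρ ρ' L

        |ps| : length ps ≤ suc m
        |ps| = subst (_≤ suc m) (sym (trans (Listₚ.length-++ xs) (cong (length xs +_) (Listₚ.length-map _ L)))) small

        -- All pebble pairs occur at positions after the first, so overwriting the first one loses
        -- none. Surplus positions repeat `p₀`.
        covering : Σ (Fin ℓ → Vx a × Vx b) λ c → SameColour ℓ N₀ (Gr a) (Gr b) (proj₁ ∘ c) (proj₂ ∘ c) ×
          (∀ {p} → p ∈ ps → ∃ λ j → c (fs j) ≡ p)
        covering with ps in eq
        ... | [] = (λ i → proj₁ (realised a b) i , proj₁ (proj₂ (realised a b)) i) ,
                   proj₂ (proj₂ (realised a b)) , λ ()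
        ... | p₀ ∷ qs = c , play w (proj₁ ∘ c) (proj₂ ∘ c) (λ i → subst (c i ∈_) (sym eq) (c-∈ i)) , hit
          where
          c : Fin ℓ → Vx a × Vx b
          c fz     = p₀
          c (fs j) = nth p₀ (p₀ ∷ qs) (toℕ j)
          c-∈ : ∀ i → c i ∈ p₀ ∷ qs
          c-∈ fz     = here refl
          c-∈ (fs j) = nth-∈ (here refl) (p₀ ∷ qs) id (toℕ j)
          hit : ∀ {p} → p ∈ p₀ ∷ qs → ∃ λ j → c (fs j) ≡ p
          hit {p} p∈ with position {d = p₀} p∈
          ... | i , i< , e = fromℕ< i<' , trans (cong (nth p₀ (p₀ ∷ qs)) (Finₚ.toℕ-fromℕ< i<')) e
            where
            i<' : i < suc m
            i<' = ℕₚ.≤-trans i< (subst (λ l → length l ≤ suc m) eq |ps|)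

      opaque
        -- Stability gives the covering tuples a bijection that also works for the next round; `x`
        -- and its image go to the free first position, and any other arrangement of the pairs is a
        -- reindexing. One bijection answers all `x`, which the counting arguments rely on.
        W-ext : Σ (Vx a ↔ Vx b) λ π → ∀ x → W a b ρ ρ' L ((x , Inverse.to π x) ∷ xs)
        W-ext with covering
        ... | c , E , hit with stable a b _ _ E
        ...   | _ , π , h = π , λ x → mkW λ u v mem →
          let idx : ∀ i → ∃ λ j → (_[_/_] {ℓ} {Gr a} (proj₁ ∘ c) x fz j ≡ u i) ×
                                (_[_/_] {ℓ} {Gr b} (proj₂ ∘ c) (Inverse.to π x) fz j ≡ v i)
              idx i = locate (mem i)
          in sameColour-cong N₀ (λ i → proj₁ (proj₂ (idx i))) (λ i → proj₂ (proj₂ (idx i)))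
               (sameColour-reindex N₀ (λ i → proj₁ (idx i)) (h x fz))
          where
          locate : ∀ {x y y'} → (y , y') ∈ (x , Inverse.to π x) ∷ ps →
            ∃ λ j → (_[_/_] {ℓ} {Gr a} (proj₁ ∘ c) x fz j ≡ y) ×
                    (_[_/_] {ℓ} {Gr b} (proj₂ ∘ c) (Inverse.to π x) fz j ≡ y')
          locate (here refl) = fz , refl , refl
          locate (there q) with hit q
          ... | j , e = fs j , cong proj₁ e , cong proj₂ e

      W-forth : ∀ x → ∃ λ x' → W a b ρ ρ' L ((x , x') ∷ xs)
      W-forth x = _ , proj₂ W-ext x

      W-back : ∀ x' → ∃ λ x → W a b ρ ρ' L ((x , x') ∷ xs)
      W-back x' = Inverse.from (proj₁ W-ext) x' ,
        subst (λ z → W a b ρ ρ' L ((Inverse.from (proj₁ W-ext) x' , z) ∷ xs))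
          (Inverse.strictlyInverseˡ (proj₁ W-ext) x') (proj₂ W-ext (Inverse.from (proj₁ W-ext) x'))

  W-trans : ∀ {a b c ρ₁ ρ₂ ρ₃ L x y z} → W a b ρ₁ ρ₂ L ((x , y) ∷ []) → W b c ρ₂ ρ₃ L ((y , z) ∷ []) →
    W a c ρ₁ ρ₃ L ((x , z) ∷ [])
  W-trans {a} {b} {c} {ρ₁} {ρ₂} {ρ₃} {L} {x} {y} {z} (mkW p) (mkW q) = mkW λ u w h →
    sameColour-trans N₀ (p u (λ i → proj₁ (mid (h i))) (λ i → proj₁ (proj₂ (mid (h i)))))
                        (q (λ i → proj₁ (mid (h i))) w (λ i → proj₂ (proj₂ (mid (h i)))))
    where
    mid : ∀ {r t} → (r , t) ∈ (x , z) ∷ pebbles a c ρ₁ ρ₃ L →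
      ∃ λ s → ((r , s) ∈ (x , y) ∷ pebbles a b ρ₁ ρ₂ L) × ((s , t) ∈ (y , z) ∷ pebbles b c ρ₂ ρ₃ L)
    mid (here refl) = y , here refl , here refl
    mid (there h) with ∈-map⁻ _ h
    ... | t , t∈L , refl = ρ₂ t , pebble ((x , y) ∷ []) t∈L , pebble ((y , z) ∷ []) t∈L

  W-iso : ∀ {a b ρ ρ' L x} (σ : Iso (Gr a) (Gr b)) → (∀ {t} → t ∈ L → ρ' t ≡ Inverse.to (proj₁ σ) (ρ t)) →
    W a b ρ ρ' L ((x , Inverse.to (proj₁ σ) x) ∷ [])
  W-iso {a} {b} {ρ} {ρ'} {L} {x} σ fix = mkW λ u v h →
    sameColour-cong N₀ (λ _ → refl) (λ i → sym (image (h i))) (sameColour-iso N₀ σ u)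
    where
    image : ∀ {r s} → (r , s) ∈ (x , Inverse.to (proj₁ σ) x) ∷ pebbles a b ρ ρ' L → s ≡ Inverse.to (proj₁ σ) r
    image (here refl) = refl
    image (there h) with ∈-map⁻ _ h
    ... | t , t∈L , refl = fix t∈L

  W-agree : ∀ {a b ρ σ σ' L xs} → (∀ {t} → t ∈ L → σ t ≡ σ' t) → W a b ρ σ L xs → W a b ρ σ' L xs
  W-agree {a} {b} {ρ} {σ} {σ'} {L} {xs} agree = W-mono conv
    where
    conv : ∀ {r s} → (r , s) ∈ xs ++ pebbles a b ρ σ' L → (r , s) ∈ xs ++ pebbles a b ρ σ L
    conv h with ∈-++⁻ xs h
    ... | inj₁ q = ∈-++⁺ˡ q
    ... | inj₂ q with ∈-map⁻ _ q
    ...   | t , t∈L , refl rewrite sym (agree t∈L) = pebble xs t∈L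

  -- Residual relation, reachability and strong components

  -- The residual carried to either side: `N` stays indexed by vertices of `G`, and `ρ` locates
  -- their pebbles. On the side `true` with `ρ` the identity it is `residual N`.
  res : ∀ a → (V G → Vx a) → Form → Vx a → Vx a → Bool
  res a ρ N x y = adj (Gr a) x y xor
    dot (λ u → adj (Gr a) x (ρ u)) (λ u → dot (N u) (λ w → adj (Gr a) (ρ w) y))

  Reach : ∀ a → (V G → Vx a) → Form → Vx a → Vx a → Set
  Reach a ρ N = Star (λ x y → res a ρ N x y ≡ true)

  SCC : ∀ a → (V G → Vx a) → Form → Vx a → Vx a → Set
  SCC a ρ N x y = Reach a ρ N x y × Reach a ρ N y x

  SCC-refl : ∀ {a ρ N x} → SCC a ρ N x x
  SCC-refl = ε , ε

  SCC-sym : ∀ {a ρ N x y} → SCC a ρ N x y → SCC a ρ N y x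
  SCC-sym = swap

  SCC-trans : ∀ {a ρ N x y z} → SCC a ρ N x y → SCC a ρ N y z → SCC a ρ N x z
  SCC-trans (p , q) (r , s) = p ◅◅ r , s ◅◅ q

  res-false : ∀ {a b ρ ρ' N x y x' y'} →
    (∀ {u w} → N u w ≡ true → adj (Gr a) x (ρ u) ≡ adj (Gr b) x' (ρ' u) × adj (Gr a) (ρ w) y ≡ adj (Gr b) (ρ' w) y') →
    res a ρ N x y ≡ false → res b ρ' N x' y' ≡ false → adj (Gr a) x y ≡ adj (Gr b) x' y'
  res-false h p q = trans (xor-cancel p) (trans (bilinear-cong h) (sym (xor-cancel q)))

  Supp : Form → List (V G) → Set
  Supp N L = Supported N L L

  module _ {N : Form} {L : List (V G)} (supp : Supp N L) where

    -- The two pairs need not be pebbled together: where residuals vanish, adjacency is a function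
    -- of the separate adjacencies to the pebbles.
    W-res-false : ∀ {a b ρ ρ' x y x' y'} → W a b ρ ρ' L ((x , x') ∷ []) → W a b ρ ρ' L ((y , y') ∷ []) →
      res a ρ N x y ≡ false → res b ρ' N x' y' ≡ false → adj (Gr a) x y ≡ adj (Gr b) x' y'
    W-res-false {a} {b} {ρ} {ρ'} wx wy = res-false {ρ = ρ} {ρ' = ρ'} λ t →
      proj₂ (proj₂ (W-pair wx at₀ (pebble (_ ∷ []) (proj₁ (supp t))))) ,
      proj₂ (proj₂ (W-pair wy (pebble (_ ∷ []) (proj₂ (supp t))) at₀))

    W-res : ∀ {a b ρ ρ' x y x' y'} → W a b ρ ρ' L ((x , x') ∷ (y , y') ∷ []) →
      res a ρ N x y ≡ res b ρ' N x' y'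
    W-res {a} {b} {ρ} {ρ'} w = cong₂ _xor_ (proj₂ (proj₂ (W-pair w at₀ at₁)))
      (bilinear-cong λ t →
        proj₂ (proj₂ (W-pair w at₀ (pebble (_ ∷ _ ∷ []) (proj₁ (supp t))))) ,
        proj₂ (proj₂ (W-pair w (pebble (_ ∷ _ ∷ []) (proj₂ (supp t))) at₁)))

    module _ (small : 2 + length L ≤ suc m) where

      -- Duplicator follows the path: the next vertex takes a third pebble, then the pebble on the
      -- previous one is lifted.
      W-reach : ∀ {a b ρ ρ' x y x' y'} → W a b ρ ρ' L ((x , x') ∷ (y , y') ∷ []) →
        Reach a ρ N x y → Reach b ρ' N x' y'
      W-reach {a} {b} {ρ} {ρ'} w ε = subst (Reach b ρ' N _) (proj₁ (proj₁ (proj₂ (W-pair w at₀ at₁))) refl) ε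
      W-reach w (_◅_ {j = z} d r) with W-forth w small z
      ... | z' , w' = trans (sym (W-res (W-weaken id swap-⊆ w'))) d ◅
                      W-reach (W-weaken id (λ { at₀ → at₀ ; at₁ → at₂ }) w') r

      W-SCC : ∀ {a b ρ ρ' x y x' y'} → W a b ρ ρ' L ((x , x') ∷ (y , y') ∷ []) →
        SCC a ρ N x y → SCC b ρ' N x' y'
      W-SCC w (p , q) = W-reach w p , W-reach (W-weaken id swap-⊆ w) q

      private
        small₁ : 1 + length L ≤ suc m
        small₁ = ℕₚ.≤-trans (ℕₚ.n≤1+n _) small

      -- If x′ and y′ were ordered the other way round, the cones of x and y
      -- would inject into each other, although that of y is strictly smaller.
      order : ∀ {a b ρ ρ' x y x' y'} → W a b ρ ρ' L ((x , x') ∷ []) → W a b ρ ρ' L ((y , y') ∷ []) →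
        Reach a ρ N x y → ¬ Reach a ρ N y x → ¬ Reach b ρ' N y' x'
      order {a} {b} {ρ} {ρ'} {x} {y} {x'} {y'} wx wy xy ¬yx yx' =
        dn-∀ (λ z → ¬¬-excluded-middle {A = Reach a ρ N x z}) λ dec →
          injectiveOn⇒surjectiveOn dec f (λ z xz → xy ◅◅ shrink xz)
            (λ z z' _ _ eq → to-injective πx (to-injective (↔-sym πy) eq))
            x ε (λ z xz eq → ¬yx (subst (Reach a ρ N y) eq (shrink xz)))
        where
        πx = proj₁ (W-ext wx small₁)
        πy = proj₁ (W-ext wy small₁)
        f : Vx a → Vx a
        f z = Inverse.from πy (Inverse.to πx z)
        shrink : ∀ {z} → Reach a ρ N x z → Reach a ρ N y (f z)
        shrink {z} xz = W-reach {b} {a} {ρ'} {ρ}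
          (W-sym (W-weaken id swap-⊆
            (subst (λ t → W a b ρ ρ' L ((f z , t) ∷ (y , y') ∷ []))
              (Inverse.strictlyInverseˡ πy (Inverse.to πx z)) (proj₂ (W-ext wy small₁) (f z)))))
          (yx' ◅◅ W-reach (W-weaken id swap-⊆ (proj₂ (W-ext wx small₁) z)) xz)

      -- Between distinct components some direction carries no arc. By `order`, one such direction
      -- can be chosen for both sides, and there adjacency is read off the pebbles.
      SCC-cross : ∀ {a b ρ ρ' x y x' y'} → W a b ρ ρ' L ((x , x') ∷ []) → W a b ρ ρ' L ((y , y') ∷ []) →
        Dec (Reach a ρ N x y) → Dec (Reach b ρ' N x' y') →
        ¬ SCC a ρ N x y → ¬ SCC b ρ' N x' y' → adj (Gr a) x y ≡ adj (Gr b) x' y'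
      SCC-cross {a} {b} {ρ} {ρ'} {x} {y} {x'} {y'} wx wy dec dec' ¬s ¬s' with dec | dec'
      ... | yes xy | _ = trans (adj-sym (Gr a) x y) (trans
            (W-res-false wy wx (unreached (λ yx → ¬s (xy , yx))) (unreached (order wx wy xy (λ yx → ¬s (xy , yx)))))
            (adj-sym (Gr b) y' x'))
        where
        unreached : ∀ {c σ p q} → ¬ Reach c σ N p q → res c σ N p q ≡ false
        unreached ¬pq = ¬true⇒false (λ h → ¬pq (h ◅ ε))
      ... | no ¬xy | no ¬xy' = W-res-false wx wy (¬true⇒false (λ h → ¬xy (h ◅ ε))) (¬true⇒false (λ h → ¬xy' (h ◅ ε)))
      ... | no ¬xy | yes xy' = trans (adj-sym (Gr a) x y) (trans
            (W-res-false wy wx (¬true⇒false (λ h → order (W-sym wx) (W-sym wy) xy' ¬yx' (h ◅ ε)))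
              (¬true⇒false (λ h → ¬yx' (h ◅ ε))))
            (adj-sym (Gr b) y' x'))
        where
        ¬yx' : ¬ Reach b ρ' N y' x'
        ¬yx' yx' = ¬s' (xy' , yx')

  -- Colour-preserving partial isomorphisms and the inductive claim

  open PartialIso

  PIso : ∀ a b → (V G → Vx a) → (V G → Vx b) → List (V G) → (Vx a → Set) → (Vx b → Set) → Set
  PIso a b ρ ρ' L P P' = PartialIso (Gr a) (Gr b) P P' (λ x y → W a b ρ ρ' L ((x , y) ∷ []))

  Pointed : ∀ a b → (V G → Vx a) → (V G → Vx b) → List (V G) → (Vx a → Set) → (Vx b → Set) → Vx a → Vx b → Set
  Pointed a b ρ ρ' L P P' x y = Σ (PIso a b ρ ρ' L P P') λ φ → to φ x ≡ y

  PIso-sym : ∀ {a b ρ ρ' L P P'} → PIso a b ρ ρ' L P P' → PIso b a ρ' ρ L P' P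
  PIso-sym {a} {b} {ρ} {ρ'} {L} φ = record
    { to = from φ ; from = to φ ; to-in = from-in φ ; from-in = to-in φ
    ; from-to = to-from φ ; to-from = from-to φ
    ; adj-to = λ px py → sym (trans (adj-to φ (from-in φ px) (from-in φ py))
        (cong₂ (adj (Gr b)) (to-from φ px) (to-from φ py)))
    ; col-to = λ {x} px → W-sym (subst (λ z → W a b ρ ρ' L ((from φ x , z) ∷ [])) (to-from φ px)
        (col-to φ (from-in φ px)))
    }

  PIso-trans : ∀ {a b c ρ₁ ρ₂ ρ₃ L P Q R} → PIso a b ρ₁ ρ₂ L P Q → PIso b c ρ₂ ρ₃ L Q R → PIso a c ρ₁ ρ₃ L P R
  PIso-trans φ ψ = record
    { to = to ψ ∘ to φ ; from = from φ ∘ from ψ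
    ; to-in = to-in ψ ∘ to-in φ ; from-in = from-in φ ∘ from-in ψ
    ; from-to = λ p → trans (cong (from φ) (from-to ψ (to-in φ p))) (from-to φ p)
    ; to-from = λ p → trans (cong (to ψ) (to-from φ (from-in ψ p))) (to-from ψ p)
    ; adj-to = λ p q → trans (adj-to φ p q) (adj-to ψ (to-in φ p) (to-in φ q))
    ; col-to = λ p → W-trans (col-to φ p) (col-to ψ (to-in φ p))
    }

  PIso-map : ∀ {a b ρ ρ' L P P' Q Q'} (φ : PIso a b ρ ρ' L P P') → (∀ {x} → Q x → P x) → (∀ {x} → Q' x → P' x) →
    (∀ {x} → Q x → Q' (to φ x)) → (∀ {x} → Q' x → Q (from φ x)) → PIso a b ρ ρ' L Q Q'
  PIso-map φ f f' g g' = record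
    { to = to φ ; from = from φ ; to-in = g ; from-in = g'
    ; from-to = λ q → from-to φ (f q) ; to-from = λ q → to-from φ (f' q)
    ; adj-to = λ p q → adj-to φ (f p) (f q) ; col-to = λ q → col-to φ (f q) }

  W-refl : ∀ {a ρ L x} → W a a ρ ρ L ((x , x) ∷ [])
  W-refl {a} = W-iso {a} {a} (iso-refl {0} {Gr a}) (λ _ → refl)

  -- The side `b` may also be `true`: isomorphisms between components of `G` itself are needed in
  -- `piece₀`.
  Claim : VSet G → List (V G) → Form → Set
  Claim X L N = ∀ b ρ v v' → X v ≡ true → W true b id ρ L ((v , v') ∷ []) →
    DN (Pointed true b id ρ L (SCC true id N v) (SCC b ρ N v') v v')

  -- A child with its own pebbles `L₀` among the pebbles `L` of the node. Through `X∩L⊆L₀`,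
  -- component automorphisms over `L₀` will fix all of `L`.
  record Part (L : List (V G)) : Set where
    field
      X     : VSet G
      L₀    : List (V G)
      N     : Form
      supp  : Supp N L₀
      L₀⊆L  : L₀ ⊆ L
      X∩L⊆L₀ : ∀ {t} → t ∈ L → X t ≡ true → t ∈ L₀
      small₀ : 2 + length L₀ ≤ suc m
      cut   : ∀ x y → X x ≡ true → X y ≡ false → res true id N x y ≡ false
      claim : Claim X L₀ N

  -- Closing a part under equal colours over all pebbles

  module Saturation {L : List (V G)} (p : Part L) (small : 2 + length L ≤ suc m) where

    open Part p public

    private
      small₁ : 1 + length L ≤ suc m
      small₁ = ℕₚ.≤-trans (ℕₚ.n≤1+n _) small

    -- X is not definable from the pebbles on L, but its closure under
    -- W-equivalence is, and it satisfies the same cut condition.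
    I : ∀ a → (V G → Vx a) → Vx a → Set
    I a ρ x = ∃ λ x₁ → X x₁ ≡ true × W true a id ρ L ((x₁ , x) ∷ [])

    I-W : ∀ {a b ρ ρ' x x'} → W a b ρ ρ' L ((x , x') ∷ []) → I a ρ x → I b ρ' x'
    I-W w (x₁ , h , w₁) = x₁ , h , W-trans w₁ w

    -- Replace `x` by an equivalent `x₁` in `X` and answer `y` by some `y₁`; then `y₁` is outside
    -- `X`, where the residual vanishes.
    I-cut : ∀ {a ρ x y} → I a ρ x → ¬ I a ρ y → res a ρ N x y ≡ false
    I-cut {a} {ρ} {x} {y} (x₁ , h , w₁) ¬Iy with W-back w₁ small₁ y
    ... | y₁ , w₂ = trans (sym (W-res supp (W-weaken L₀⊆L swap-⊆ w₂)))
          (cut x₁ y₁ h (¬true⇒false λ h' → ¬Iy (y₁ , h' , W-weaken id head-⊆ w₂)))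

    I-reach : ∀ {a ρ x y} → I a ρ x → Reach a ρ N x y → DN (I a ρ y)
    I-reach Ix ε = return Ix
    I-reach {a} {ρ} Ix (_◅_ {j = z} d r) ¬Iy = ¬¬-excluded-middle {A = I a ρ z} λ
      { (yes Iz) → I-reach Iz r ¬Iy
      ; (no ¬Iz) → true≢false (trans (sym d) (I-cut Ix ¬Iz)) }

    I-pebble : ∀ {a ρ t} → t ∈ L → I a ρ (ρ t) → t ∈ L₀
    I-pebble {a} {ρ} {t} t∈L (x₁ , h , w) =
      X∩L⊆L₀ t∈L (subst (λ z → X z ≡ true)
        (proj₂ (proj₁ (proj₂ (W-pair w (here refl) (pebble (_ ∷ []) t∈L)))) refl) h)

    -- `x` itself may lie outside `X`, so both components are compared with that of an equivalent
    -- `x₁` in `X`.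
    piece₀ : ∀ {b ρ x x'} → I true id x → W true b id ρ L ((x , x') ∷ []) →
      DN (Pointed true b id ρ L₀ (SCC true id N x) (SCC b ρ N x') x x')
    piece₀ {b} {ρ} {x} {x'} (x₁ , h , w₁) w = do
      φ , φx ← claim true id x₁ x h (W-weaken L₀⊆L id w₁)
      ψ , ψx ← claim b ρ x₁ x' h (W-weaken L₀⊆L id (W-trans w₁ w))
      return (PIso-trans (PIso-sym φ) ψ ,
        trans (cong (to ψ) (trans (cong (from φ) (sym φx)) (from-to φ SCC-refl))) ψx)

    module _ (reach? : ∀ x y → Dec (Reach true id N x y)) where

      private
        scc? : ∀ x y → Dec (SCC true id N x y)
        scc? x y = reach? x y ×-dec reach? y x

      -- An automorphism of a strong component inside I extends by the
      -- identity: all edges between the component and an outside vertex are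
      -- governed by the same half of the residual relation.
      module _ {x : V G} (Ix : I true id x)
               (α : PIso true true id id L₀ (SCC true id N x) (SCC true id N x)) where

        private
          S : V G → Set
          S = SCC true id N x

          outer : ∀ {y z w} → S y → S z → ¬ S w → W true true id id L₀ ((y , z) ∷ []) → adj G y w ≡ adj G z w
          outer {y} {z} {w} Sy Sz ¬Sw wyz with reach? w x
          ... | yes wx = W-res-false supp wyz W-refl (leaving Sy) (leaving Sz)
            where
            leaving : ∀ {y} → S y → res true id N y w ≡ false
            leaving Sy = ¬true⇒false λ h → ¬Sw (proj₁ Sy ◅◅ (h ◅ ε) , wx)
          ... | no ¬wx = trans (adj-sym G y w) (trans
                  (W-res-false supp W-refl wyz (entering Sy) (entering Sz)) (adj-sym G w z))
            where
            entering : ∀ {y} → S y → res true id N w y ≡ false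
            entering Sy = ¬true⇒false λ h → ¬wx (h ◅ proj₂ Sy)

          ext : PIso true true id id L₀ S S → V G → V G
          ext β y with scc? x y
          ... | yes _ = to β y
          ... | no _  = y

          ext-∘ : (β γ : PIso true true id id L₀ S S) → (∀ {y} → S y → to β (to γ y) ≡ y) → ∀ y → ext β (ext γ y) ≡ y
          ext-∘ β γ h y with scc? x y
          ext-∘ β γ h y | yes Sy with scc? x (to γ y)
          ... | yes _ = h Sy
          ... | no ¬S = ⊥-elim (¬S (to-in γ Sy))
          ext-∘ β γ h y | no ¬Sy with scc? x y
          ... | yes Sy = ⊥-elim (¬Sy Sy)
          ... | no _ = refl

          ext-adj : ∀ y z → adj G y z ≡ adj G (ext α y) (ext α z)
          ext-adj y z with scc? x y | scc? x z
          ... | yes Sy | yes Sz = adj-to α Sy Sz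
          ... | yes Sy | no ¬Sz = outer Sy (to-in α Sy) ¬Sz (col-to α Sy)
          ... | no ¬Sy | yes Sz = trans (adj-sym G y z) (trans (outer Sz (to-in α Sz) ¬Sy (col-to α Sz)) (adj-sym G (to α z) y))
          ... | no _   | no _   = refl

          ext-col : ∀ y → col G y ≡ col G (ext α y)
          ext-col y with scc? x y
          ... | yes Sy = proj₁ (W-pair (col-to α Sy) (here refl) (here refl))
          ... | no _   = refl

          extended : Iso G G
          extended = mk↔ₛ′ (ext α) (ext (PIso-sym α)) (ext-∘ α (PIso-sym α) (to-from α)) (ext-∘ (PIso-sym α) α (from-to α)) ,
            ext-adj , ext-col

          fixes : ∀ {t} → t ∈ L → t ≡ ext α t
          fixes {t} t∈L with scc? x t
          ... | no _   = refl
          -- A pebble in the component lies in `I`, hence in `L₀`, and `α` preserves colours over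
          -- `L₀`.
          ... | yes St = decidable-stable (t ≟ to α t) do
                It ← I-reach Ix (proj₁ St)
                return (proj₁ (proj₁ (proj₂ (W-pair (col-to α St) (pebble (_ ∷ []) (I-pebble t∈L It)) (here refl)))) refl)

        automorphic : ∀ {y} → S y → W true true id id L ((y , to α y) ∷ [])
        automorphic {y} Sy = subst (λ z → W true true id id L ((y , z) ∷ [])) ext-y (W-iso extended fixes)
          where
          ext-y : ext α y ≡ to α y
          ext-y with scc? x y
          ... | yes _ = refl
          ... | no ¬S = ⊥-elim (¬S Sy)

      -- An isomorphism of strong components automatically preserves colours
      -- over all of L: compare it with the isomorphism pointed at the image of y.
      colours : ∀ {b ρ x x'} → I true id x → W true b id ρ L ((x , x') ∷ []) →
        (φ : PIso true b id ρ L₀ (SCC true id N x) (SCC b ρ N x')) →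
        ∀ y → SCC true id N x y → DN (W true b id ρ L ((y , to φ y) ∷ []))
      colours {b} {ρ} {x} {x'} Ix w φ y Sy = do
        Iz ← I-reach Ix (proj₁ Sz)
        ψ , ψz ← piece₀ Iz wz
        let α = PIso-trans (PIso-map ψ (SCC-trans (SCC-sym Sz)) (SCC-trans (SCC-sym (to-in φ Sy)))
                  (λ S → SCC-trans (to-in φ Sy) (to-in ψ (SCC-trans (SCC-sym Sz) S)))
                  (λ S → SCC-trans Sz (from-in ψ (SCC-trans (SCC-sym (to-in φ Sy)) S)))) (PIso-sym φ)
            αz : to α z ≡ y
            αz = trans (cong (from φ) ψz) (from-to φ Sy)
        return (W-trans (W-sym (subst (λ t → W true true id id L ((z , t) ∷ [])) αz (automorphic Ix α Sz))) wz)
        where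
        -- Answering `to φ y` while `(x , x')` stays pebbled keeps `z` in the component of `x`;
        -- going along `ψ` and back along `φ` is then an automorphism taking `z` to `y`.
        z : V G
        z = proj₁ (W-back w small₁ (to φ y))
        wzx : W true b id ρ L ((z , to φ y) ∷ (x , x') ∷ [])
        wzx = proj₂ (W-back w small₁ (to φ y))
        wz : W true b id ρ L ((z , to φ y) ∷ [])
        wz = W-weaken id head-⊆ wzx
        Sz : SCC true id N x z
        Sz = W-SCC supp small₀ (W-sym (W-weaken L₀⊆L swap-⊆ wzx))
          (to-in φ Sy)

      piece : ∀ {b ρ x x'} → I true id x → W true b id ρ L ((x , x') ∷ []) →
        DN (Pointed true b id ρ L (SCC true id N x) (SCC b ρ N x') x x')
      piece Ix w = do
        φ , φx ← piece₀ Ix w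
        c ← dn-∀ (λ y → dn-→ (colours Ix w φ y))
        return (record { to = to φ ; from = from φ ; to-in = to-in φ ; from-in = from-in φ ; from-to = from-to φ
                       ; to-from = to-from φ ; adj-to = adj-to φ ; col-to = λ {y} Sy → c y Sy } , φx)

  -- Where the two saturations overlap, the first one takes precedence.
  module Union {L : List (V G)} (p₁ p₂ : Part L) (small : 2 + length L ≤ suc m) where

    module S₁ = Saturation p₁ small
    module S₂ = Saturation p₂ small

    U : ∀ a → (V G → Vx a) → Vx a → Set
    U a ρ x = S₁.I a ρ x ⊎ S₂.I a ρ x

    U-W : ∀ {a b ρ ρ' x x'} → W a b ρ ρ' L ((x , x') ∷ []) → U a ρ x → U b ρ' x'
    U-W w (inj₁ i) = inj₁ (S₁.I-W w i)
    U-W w (inj₂ i) = inj₂ (S₂.I-W w i)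

    Class : ∀ a → (V G → Vx a) → Vx a → Vx a → Set
    Class a ρ x y = (S₁.I a ρ x × S₁.I a ρ y × SCC a ρ S₁.N x y) ⊎
                    (¬ S₁.I a ρ x × ¬ S₁.I a ρ y × SCC a ρ S₂.N x y)

    Class-sym : ∀ {a ρ x y} → Class a ρ x y → Class a ρ y x
    Class-sym (inj₁ (i , j , s)) = inj₁ (j , i , SCC-sym s)
    Class-sym (inj₂ (i , j , s)) = inj₂ (j , i , SCC-sym s)

    Class-trans : ∀ {a ρ x y z} → Class a ρ x y → Class a ρ y z → Class a ρ x z
    Class-trans (inj₁ (i , _ , s)) (inj₁ (_ , k , t)) = inj₁ (i , k , SCC-trans s t)
    Class-trans (inj₂ (i , _ , s)) (inj₂ (_ , k , t)) = inj₂ (i , k , SCC-trans s t)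
    Class-trans (inj₁ (_ , j , _)) (inj₂ (¬j , _ , _)) = ⊥-elim (¬j j)
    Class-trans (inj₂ (_ , ¬j , _)) (inj₁ (j , _ , _)) = ⊥-elim (¬j j)

    record Decisions (a : Bool) (ρ : V G → Vx a) : Set where
      field
        reach₁ : ∀ x y → Dec (Reach a ρ S₁.N x y)
        reach₂ : ∀ x y → Dec (Reach a ρ S₂.N x y)
        in₁    : ∀ x → Dec (S₁.I a ρ x)
        in₂    : ∀ x → Dec (S₂.I a ρ x)

      U? : ∀ x → Dec (U a ρ x)
      U? x = in₁ x ⊎-dec in₂ x

      class? : ∀ x y → Dec (Class a ρ x y)
      class? x y = (in₁ x ×-dec in₁ y ×-dec reach₁ x y ×-dec reach₁ y x) ⊎-dec
                   (¬? (in₁ x) ×-dec ¬? (in₁ y) ×-dec reach₂ x y ×-dec reach₂ y x)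

      I₁-SCC : ∀ {x y} → S₁.I a ρ x → SCC a ρ S₁.N x y → S₁.I a ρ y
      I₁-SCC {y = y} i s = decidable-stable (in₁ y) (S₁.I-reach i (proj₁ s))

      class-U : ∀ {x y} → Class a ρ x y → U a ρ x → U a ρ y
      class-U {y = y} (inj₁ (_ , j , _)) _ = inj₁ j
      class-U {y = y} (inj₂ (¬i , _ , _)) (inj₁ i) = ⊥-elim (¬i i)
      class-U {y = y} (inj₂ (_ , _ , s)) (inj₂ i) = inj₂ (decidable-stable (in₂ y) (S₂.I-reach i (proj₁ s)))

      class-refl : ∀ {x} → Class a ρ x x
      class-refl {x} with in₁ x
      ... | yes i = inj₁ (i , i , SCC-refl)
      ... | no ¬i = inj₂ (¬i , ¬i , SCC-refl)

    decisions : ∀ a ρ → DN (Decisions a ρ)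
    decisions a ρ = do
      r₁ ← dn-∀ (λ x → dn-∀ (λ y → ¬¬-excluded-middle))
      r₂ ← dn-∀ (λ x → dn-∀ (λ y → ¬¬-excluded-middle))
      i₁ ← dn-∀ (λ x → ¬¬-excluded-middle)
      i₂ ← dn-∀ (λ x → ¬¬-excluded-middle)
      return (record { reach₁ = r₁ ; reach₂ = r₂ ; in₁ = i₁ ; in₂ = i₂ })

    module _ {b : Bool} {ρ : V G → Vx b} (d : Decisions true id) (d' : Decisions b ρ) where

      private
        module d = Decisions d
        module d' = Decisions d'

        Col : V G → Vx b → Set
        Col x y = W true b id ρ L ((x , y) ∷ [])

      class-piece : ∀ x y → U true id x → Col x y →
        DN (Pointed true b id ρ L (Class true id x) (Class b ρ y) x y)
      class-piece x y u w with d.in₁ x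
      ... | yes i = do
            φ , φx ← S₁.piece d.reach₁ i w
            return (PIso-map φ
              (λ { (inj₁ (_ , _ , s)) → s ; (inj₂ (¬i , _)) → ⊥-elim (¬i i) })
              (λ { (inj₁ (_ , _ , s)) → s ; (inj₂ (¬i , _)) → ⊥-elim (¬i i') })
              (λ { (inj₁ (_ , j , s)) → inj₁ (i' , S₁.I-W (col-to φ s) j , to-in φ s) ; (inj₂ (¬i , _)) → ⊥-elim (¬i i) })
              (λ { (inj₁ (_ , _ , s)) → inj₁ (i , d.I₁-SCC i (from-in φ s) , from-in φ s) ; (inj₂ (¬i , _)) → ⊥-elim (¬i i') })
              , φx)
        where
        i' : S₁.I b ρ y
        i' = S₁.I-W w i
      class-piece x y (inj₁ i) w | no ¬i = ⊥-elim (¬i i)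
      class-piece x y (inj₂ i₂) w | no ¬i = do
            φ , φx ← S₂.piece d.reach₂ i₂ w
            return (PIso-map φ
              (λ { (inj₂ (_ , _ , s)) → s ; (inj₁ (i , _)) → ⊥-elim (¬i i) })
              (λ { (inj₂ (_ , _ , s)) → s ; (inj₁ (i , _)) → ⊥-elim (¬i' i) })
              (λ { (inj₂ (_ , ¬j , s)) → inj₂ (¬i' , (λ j → ¬j (S₁.I-W (W-sym (col-to φ s)) j)) , to-in φ s)
                 ; (inj₁ (i , _)) → ⊥-elim (¬i i) })
              (λ { (inj₂ (_ , ¬j , s)) → inj₂ (¬i , (λ j → ¬j (S₁.I-W (W-sym (col-to (PIso-sym φ) s)) j)) , from-in φ s)
                 ; (inj₁ (i , _)) → ⊥-elim (¬i' i) })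
              , φx)
        where
        ¬i' : ¬ S₁.I b ρ y
        ¬i' i = ¬i (S₁.I-W (W-sym w) i)

      -- Two vertices on the same side of `S₁.I` fall under `SCC-cross`. In the mixed case no arc of
      -- the first part leaves `S₁.I`, in either graph.
      class-cross : ∀ {x y z w} → Col x y → Col z w → ¬ Class true id x z → ¬ Class b ρ y w →
        adj G x z ≡ adj (Gr b) y w
      class-cross {x} {y} {z} {w} cx cz ¬xz ¬yw with d.in₁ x | d.in₁ z
      ... | yes i | yes j = SCC-cross S₁.supp S₁.small₀ (W-weaken S₁.L₀⊆L id cx) (W-weaken S₁.L₀⊆L id cz)
              (d.reach₁ x z) (d'.reach₁ y w) (λ s → ¬xz (inj₁ (i , j , s)))
              (λ s → ¬yw (inj₁ (S₁.I-W cx i , S₁.I-W cz j , s)))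
      ... | no ¬i | no ¬j = SCC-cross S₂.supp S₂.small₀ (W-weaken S₂.L₀⊆L id cx) (W-weaken S₂.L₀⊆L id cz)
              (d.reach₂ x z) (d'.reach₂ y w) (λ s → ¬xz (inj₂ (¬i , ¬j , s)))
              (λ s → ¬yw (inj₂ ((λ i → ¬i (S₁.I-W (W-sym cx) i)) , (λ j → ¬j (S₁.I-W (W-sym cz) j)) , s)))
      ... | yes i | no ¬j = W-res-false S₁.supp (W-weaken S₁.L₀⊆L id cx) (W-weaken S₁.L₀⊆L id cz)
              (S₁.I-cut i ¬j) (S₁.I-cut (S₁.I-W cx i) (λ j → ¬j (S₁.I-W (W-sym cz) j)))
      ... | no ¬i | yes j = trans (adj-sym G x z) (trans
              (W-res-false S₁.supp (W-weaken S₁.L₀⊆L id cz) (W-weaken S₁.L₀⊆L id cx)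
                (S₁.I-cut j ¬i) (S₁.I-cut (S₁.I-W cz j) (λ i → ¬i (S₁.I-W (W-sym cx) i))))
              (adj-sym (Gr b) w y))

    -- The gluing colours are those over `L`. Duplicator's bijection for a fresh pebble makes the
    -- colour classes equally large.
    union-iso : ∀ b ρ v v' → U true id v → W true b id ρ L ((v , v') ∷ []) →
      DN (Pointed true b id ρ L (U true id) (U b ρ) v v')
    union-iso b ρ v v' u w = do
      d ← decisions true id
      d' ← decisions b ρ
      col? ← dn-∀ (λ x → dn-∀ (λ y → ¬¬-excluded-middle {A = W true b id ρ L ((x , y) ∷ [])}))
      ps ← dn-∀ (λ x → dn-∀ (λ y → dn-→ (λ u → dn-→ (class-piece d d' x y u))))
      return (Glue.glue (record
        { U = U true id ; U' = U b ρ ; _∼_ = Class true id ; _∼'_ = Class b ρ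
        ; Col = λ x y → W true b id ρ L ((x , y) ∷ [])
        ; U? = Decisions.U? d ; U'? = Decisions.U? d'
        ; _∼?_ = Decisions.class? d ; _∼'?_ = Decisions.class? d' ; Col? = col?
        ; ∼-refl = λ _ → Decisions.class-refl d ; ∼-sym = Class-sym ; ∼-trans = Class-trans
        ; ∼-U = Decisions.class-U d ; ∼'-sym = Class-sym ; ∼'-trans = Class-trans
        ; Col-U = U-W ; Col-U' = λ c → U-W (W-sym c)
        ; Col-dif = λ c₁ c₂ c₃ → W-trans (W-trans c₁ (W-sym c₂)) c₃
        ; π = proj₁ (W-ext empty-W small₀) ; Col-π = proj₂ (W-ext empty-W small₀)
        ; piece = λ {x} {y} u c → ps x y u c
        ; cross = λ _ _ → class-cross d d'
        }) v v' u w)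
      where
      empty-W : W true b id ρ L []
      empty-W = W-weaken id (λ ()) w
      small₀ : length L ≤ suc m
      small₀ = ℕₚ.≤-trans (ℕₚ.n≤1+n _) (ℕₚ.≤-trans (ℕₚ.n≤1+n _) small)

  -- Placing further pebbles and restricting to components

  private
    _∈?_ : (t : V G) (L : List (V G)) → Dec (t ∈ L)
    _∈?_ = DecMembership._∈?_ _≟_

  -- Positions are kept as sublists of L⁺ (cov marks the vertices already
  -- pebbled), so that the pebble count never exceeds the length of L⁺.
  opaque

    place-pebbles : ∀ {b ρ L v v'} L⁺ → L ⊆ L⁺ → 1 + length L⁺ ≤ suc m → W true b id ρ L ((v , v') ∷ []) →
      ∃ λ ρ⁺ → (∀ {t} → t ∈ L → ρ t ≡ ρ⁺ t) × W true b id ρ⁺ L⁺ ((v , v') ∷ [])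
    place-pebbles {b} {ρ} {L} {v} {v'} L⁺ L⊆L⁺ small w with go L⁺ cov₀ ρ start
      where
      placed : (V G → Bool) → List (V G)
      placed cov = filter (λ t → cov t Boolₚ.≟ true) L⁺
      cov₀ : V G → Bool
      cov₀ t = does (t ∈? L)
      cov₀-∈ : ∀ {t} → cov₀ t ≡ true → t ∈ L
      cov₀-∈ {t} h with t ∈? L
      ... | yes p = p
      cov₀-∈ {t} () | no _
      start : W true b id ρ (placed cov₀) ((v , v') ∷ [])
      start = W-weaken (λ q → cov₀-∈ (proj₂ (∈-filter⁻ (λ t → cov₀ t Boolₚ.≟ true) {xs = L⁺} q))) id w
      go : ∀ M cov σ → W true b id σ (placed cov) ((v , v') ∷ []) →
        ∃ λ cov⁺ → ∃ λ σ⁺ → W true b id σ⁺ (placed cov⁺) ((v , v') ∷ []) ×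
          (∀ {t} → cov t ≡ true → cov⁺ t ≡ true × σ t ≡ σ⁺ t) × (∀ {t} → t ∈ M → cov⁺ t ≡ true)
      go [] cov σ w = cov , σ , w , (λ h → h , refl) , λ ()
      go (t ∷ M) cov σ w with cov t in eq
      ... | true with go M cov σ w
      ...   | cov⁺ , σ⁺ , w⁺ , keep , done = cov⁺ , σ⁺ , w⁺ , keep ,
              λ { (here refl) → proj₁ (keep eq) ; (there q) → done q }
      go (t ∷ M) cov σ w | false
        with W-forth w (ℕₚ.≤-trans (s≤s (Listₚ.length-filter (λ t → cov t Boolₚ.≟ true) L⁺)) small) t
      ... | t' , wt with go M cov₁ σ₁ (W-mono old wt)
        where
        cov₁ : V G → Bool
        cov₁ u with u ≟ t
        ... | yes _ = true
        ... | no _  = cov u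
        σ₁ : V G → Vx b
        σ₁ u with u ≟ t
        ... | yes _ = t'
        ... | no _  = σ u
        old-pebble : ∀ u → u ∈ L⁺ → cov₁ u ≡ true →
          (u , σ₁ u) ∈ (t , t') ∷ (v , v') ∷ pebbles true b id σ (placed cov)
        old-pebble u u∈ h with u ≟ t
        ... | yes refl = here refl
        ... | no _ = pebble ((t , t') ∷ (v , v') ∷ []) (∈-filter⁺ (λ t → cov t Boolₚ.≟ true) u∈ h)
        old : ∀ {p} → p ∈ (v , v') ∷ pebbles true b id σ₁ (placed cov₁) →
          p ∈ (t , t') ∷ (v , v') ∷ pebbles true b id σ (placed cov)
        old (here refl) = there (here refl)
        old (there q) with ∈-map⁻ _ q
        ... | u , u∈ , refl with ∈-filter⁻ (λ t → cov₁ t Boolₚ.≟ true) {xs = L⁺} u∈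
        ...   | u∈L⁺ , h = old-pebble u u∈L⁺ h
      ...   | cov⁺ , σ⁺ , w⁺ , keep , done = cov⁺ , σ⁺ , w⁺ , keep' ,
              λ { (here refl) → covered ; (there q) → done q }
        where
        covered : cov⁺ t ≡ true
        covered with t ≟ t | keep {t}
        ... | yes _ | k = proj₁ (k refl)
        ... | no ne | _ = ⊥-elim (ne refl)
        keep' : ∀ {u} → cov u ≡ true → cov⁺ u ≡ true × σ u ≡ σ⁺ u
        keep' {u} h with u ≟ t | keep {u}
        ... | yes refl | _ = ⊥-elim (true≢false (trans (sym h) eq))
        ... | no _     | k = k h
    ... | cov⁺ , ρ⁺ , w⁺ , keep , done = ρ⁺ ,
          (λ {t} t∈ → proj₂ (keep (dec-true (t ∈? L) t∈))) ,
          W-weaken (λ t∈ → ∈-filter⁺ (λ t → cov⁺ t Boolₚ.≟ true) t∈ (done t∈)) id w⁺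

  reach-inside : ∀ {X : VSet G} {N : Form} → (∀ x y → X x ≡ true → X y ≡ false → res true id N x y ≡ false) →
    ∀ {x y} → X x ≡ true → Reach true id N x y → X y ≡ true
  reach-inside cut h ε = h
  reach-inside {X} cut {x} h (_◅_ {j = z} d r) with X z in eq
  ... | true  = reach-inside cut eq r
  ... | false = ⊥-elim (true≢false (trans (sym d) (cut x z h eq)))

  -- φ preserves residual edges, and a path inside a strong component never
  -- leaves it.
  restrict : ∀ {b ρ L N U U' v v'} → Supp N L → (φ : PIso true b id ρ L U U') → to φ v ≡ v' → U v →
    (∀ {x} → SCC true id N v x → U x) → (∀ {x} → SCC b ρ N v' x → U' x) →
    Pointed true b id ρ L (SCC true id N v) (SCC b ρ N v') v v'
  restrict {b} {ρ} {L} {N} {U} {U'} {v} {v'} supp φ φv Uv S⊆U S'⊆U' =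
    PIso-map φ S⊆U S'⊆U'
      (λ s → subst (λ z → SCC b ρ N z _) φv (image s))
      (λ s → subst (λ z → SCC true id N z _) (trans (cong (from φ) (sym φv)) (from-to φ Uv)) (image' s))
    , φv
    where
    res-φ : ∀ {x y} → U x → U y → res true id N x y ≡ res b ρ N (to φ x) (to φ y)
    res-φ ux uy = cong₂ _xor_ (adj-to φ ux uy) (bilinear-cong λ t →
      proj₂ (proj₂ (W-pair (col-to φ ux) (here refl) (pebble (_ ∷ []) (proj₁ (supp t))))) ,
      proj₂ (proj₂ (W-pair (col-to φ uy) (pebble (_ ∷ []) (proj₂ (supp t))) (here refl))))
    path : ∀ {x y} → (∀ {z} → Reach true id N x z → Reach true id N z y → U z) →
      Reach true id N x y → Reach b ρ N (to φ x) (to φ y)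
    path h ε = ε
    path h (d ◅ r) = trans (sym (res-φ (h ε (d ◅ r)) (h (d ◅ ε) r))) d ◅ path (λ p q → h (d ◅ p) q) r
    path' : ∀ {x y} → (∀ {z} → Reach b ρ N x z → Reach b ρ N z y → U' z) →
      Reach b ρ N x y → Reach true id N (from φ x) (from φ y)
    path' h ε = ε
    path' {x} h (_◅_ {j = z} d r) =
      trans (res-φ (from-in φ ux) (from-in φ uz)) (trans (cong₂ (res b ρ N) (to-from φ ux) (to-from φ uz)) d)
        ◅ path' (λ p q → h (d ◅ p) q) r
      where
      ux = h ε (d ◅ r)
      uz = h (d ◅ ε) r
    image : ∀ {x} → SCC true id N v x → SCC b ρ N (to φ v) (to φ x)
    image (p , q) = path (λ r s → S⊆U (r , s ◅◅ q)) p , path (λ r s → S⊆U (p ◅◅ r , s)) q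
    image' : ∀ {x} → SCC b ρ N v' x → SCC true id N (from φ v') (from φ x)
    image' (p , q) = path' (λ r s → S'⊆U' (r , s ◅◅ q)) p , path' (λ r s → S'⊆U' (p ◅◅ r , s)) q

  -- `N` is supported on `L`, so the residual relation sees only the pebbles on which `ρ` and `σ`
  -- agree.
  reindex : ∀ {b ρ σ L N v v'} → Supp N L → (∀ {t} → t ∈ L → ρ t ≡ σ t) →
    Pointed true b id σ L (SCC true id N v) (SCC b σ N v') v v' →
    Pointed true b id ρ L (SCC true id N v) (SCC b ρ N v') v v'
  reindex {b} {ρ} {σ} {L} {N} supp agree (φ , φv) = record
    { to = to φ ; from = from φ
    ; to-in = λ s → conv (λ x y → sym (agree' x y)) (to-in φ s)
    ; from-in = λ s → from-in φ (conv agree' s)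
    ; from-to = from-to φ ; to-from = λ s → to-from φ (conv agree' s) ; adj-to = adj-to φ
    ; col-to = λ s → W-agree (λ t → sym (agree t)) (col-to φ s) } , φv
    where
    agree' : ∀ x y → res b ρ N x y ≡ res b σ N x y
    agree' x y = cong (adj (Gr b) x y xor_) (bilinear-cong λ t →
      cong (adj (Gr b) x) (agree (proj₁ (supp t))) , cong (λ z → adj (Gr b) z y) (agree (proj₂ (supp t))))
    conv : ∀ {τ τ'} → (∀ x y → res b τ N x y ≡ res b τ' N x y) →
      ∀ {x y} → SCC b τ N x y → SCC b τ' N x y
    conv {τ} {τ'} h (p , q) = Star.map (trans (sym (h _ _))) p , Star.map (trans (sym (h _ _))) q

  -- Induction along the rank decomposition

  module Decomposition (k : ℕ) (3k≤ : 2 + 3 * k ≤ suc m) where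

    open Cuts G using (Split; ChildSplits; child-splits)

    pebbled : ∀ {X} → Split X k → List (V G)
    pebbled D = Split.A D ++ Split.B D

    private
      -- The pebble budget: three families of size at most `k` and two moving pairs fit into `suc m`
      -- entries, leaving one of the `ℓ` entries for the next move.
      3k : ∀ {a b c} → a ≤ k → b ≤ k → c ≤ k → a + (b + c) ≤ 3 * k
      3k {c = c} p q r = ℕₚ.+-mono-≤ p (ℕₚ.+-mono-≤ q (ℕₚ.≤-trans r (ℕₚ.m≤m+n k 0)))

      small-pebbled : ∀ {X} (D : Split X k) → 2 + length (pebbled D) ≤ suc m
      small-pebbled D = ℕₚ.≤-trans (s≤s (s≤s (subst (_≤ 3 * k)
        (trans (cong (length (Split.A D) +_) (ℕₚ.+-identityʳ _)) (sym (Listₚ.length-++ (Split.A D))))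
        (3k (Split.|A|≤k D) (Split.|B|≤k D) (z≤n {k}))))) 3k≤

    supp-pebbled : ∀ {X} (D : Split X k) → Supp (Split.N D) (pebbled D)
    supp-pebbled D t = ∈-++⁺ʳ (Split.A D) (proj₁ (Split.supported D t)) , ∈-++⁺ˡ (proj₂ (Split.supported D t))

    -- Quantifying over `D` lets the splits of the children depend on the parent's. At a leaf no arc
    -- leaves the single vertex, so its component is trivial. At a node the missing pebbles are
    -- placed, the children glued, and the result restricted to one component.
    claim : (T : LTree G) → WellLabelled T → Width≤ G T k → (D : Split (γ T) k) →
      Claim (γ T) (pebbled D) (Split.N D)
    claim (leaf X) (v₀ , only) _ D b ρ v v' v∈X w = return (record
        { to = λ _ → v' ; from = λ _ → v
        ; to-in = λ _ → SCC-refl ; from-in = λ _ → SCC-refl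
        ; from-to = λ s → sym (single s) ; to-from = λ s → sym (single' s)
        ; adj-to = λ {x} {y} s t → trans (cong₂ (adj G) (single s) (single t))
            (trans (irrefl G v) (sym (irrefl (Gr b) v')))
        ; col-to = λ s → subst (λ z → W true b id ρ (pebbled D) ((z , v') ∷ [])) (sym (single s)) w
        } , refl)
      where
      inside : ∀ {x} → SCC true id (Split.N D) v x → X x ≡ true
      inside s = reach-inside (λ x y h → Split.cut D x h y) v∈X (proj₁ s)
      single : ∀ {x} → SCC true id (Split.N D) v x → x ≡ v
      single s = trans (proj₁ (only _) (inside s)) (sym (proj₁ (only v) v∈X))
      single' : ∀ {x} → SCC b ρ (Split.N D) v' x → x ≡ v'
      single' {x'} s' with W-back w (ℕₚ.≤-trans (ℕₚ.n≤1+n _) (small-pebbled D)) x'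
      ... | x , wx = sym (proj₁ (proj₁ (proj₂ (W-pair wx (there (here refl)) (here refl)))) (sym (single
              (W-SCC (supp-pebbled D) (small-pebbled D)
                (W-sym (W-weaken id swap-⊆ wx)) s'))))
    claim (node X t₁ t₂) (union , disj , wl₁ , wl₂) (_ , wd₁ , wd₂) D b ρ v v' v∈X w = do
      φ , φv ← Union.union-iso p₁ p₂ small b ρ⁺ v v' (U-X v∈X) w⁺
      return (reindex (supp-pebbled D) agree
        (restrict (supp-pebbled D)
          (record { to = to φ ; from = from φ ; to-in = to-in φ ; from-in = from-in φ
                  ; from-to = from-to φ ; to-from = to-from φ ; adj-to = adj-to φ
                  ; col-to = λ u → W-weaken L⊆L⁺ id (col-to φ u) })
          φv (U-X v∈X) S⊆U S'⊆U'))
      where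
      module D = Split D
      rank : (T : LTree G) → Width≤ G T k → CutRank≤ G (γ T) k
      rank (leaf _)     r       = r
      rank (node _ _ _) (r , _) = r
      C : ChildSplits D (γ t₁) (γ t₂)
      C = child-splits D (γ t₁) (γ t₂) union disj (rank t₁ wd₁) (rank t₂ wd₂)
      open ChildSplits C
      module D₁ = Split D₁
      module D₂ = Split D₂
      L⁺ : List (V G)
      L⁺ = D₁.A ++ (D₂.A ++ D.B)
      L⊆L⁺ : pebbled D ⊆ L⁺
      L⊆L⁺ q with ∈-++⁻ D.A q
      ... | inj₂ b∈ = ∈-++⁺ʳ D₁.A (∈-++⁺ʳ D₂.A b∈)
      ... | inj₁ a∈ with ∈-++⁻ D₁.A (A⊆ a∈)
      ...   | inj₁ a₁ = ∈-++⁺ˡ a₁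
      ...   | inj₂ a₂ = ∈-++⁺ʳ D₁.A (∈-++⁺ˡ a₂)
      small : 2 + length L⁺ ≤ suc m
      small = ℕₚ.≤-trans (s≤s (s≤s (subst (_≤ 3 * k)
        (sym (trans (Listₚ.length-++ D₁.A) (cong (length D₁.A +_) (Listₚ.length-++ D₂.A))))
        (3k D₁.|A|≤k D₂.|A|≤k D.|B|≤k)))) 3k≤
      extended = place-pebbles {b} {ρ} L⁺ L⊆L⁺ (ℕₚ.≤-trans (ℕₚ.n≤1+n _) small) w
      ρ⁺ : V G → Vx b
      ρ⁺ = proj₁ extended
      agree : ∀ {t} → t ∈ pebbled D → ρ t ≡ ρ⁺ t
      agree = proj₁ (proj₂ extended)
      w⁺ : W true b id ρ⁺ L⁺ ((v , v') ∷ [])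
      w⁺ = proj₂ (proj₂ extended)
      outside₁ : ∀ {t} → t ∈ D₂.A ++ D.B → γ t₁ t ≡ true → ⊥
      outside₁ {t} q h with ∈-++⁻ D₂.A q
      ... | inj₁ a₂ = true≢false (trans (sym (cong₂ _∧_ h (D₂.inside a₂))) (disj t))
      ... | inj₂ b∈ = true≢false (trans (sym (trans (union t) (cong (_∨ γ t₂ t) h))) (D.outside b∈))
      outside₂ : ∀ {t} → t ∈ D₁.A ++ D.B → γ t₂ t ≡ true → ⊥
      outside₂ {t} q h with ∈-++⁻ D₁.A q
      ... | inj₁ a₁ = true≢false (trans (sym (cong₂ _∧_ (D₁.inside a₁) h)) (disj t))
      ... | inj₂ b∈ = true≢false (trans (sym (trans (union t) (trans (cong (γ t₁ t ∨_) h) (Boolₚ.∨-zeroʳ (γ t₁ t))))) (D.outside b∈))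
      p₁ p₂ : Part L⁺
      p₁ = record
        { X = λ x → γ t₁ x ; L₀ = pebbled D₁ ; N = D₁.N ; supp = supp-pebbled D₁
        ; L₀⊆L = λ q → sub (∈-++⁻ D₁.A q)
        ; X∩L⊆L₀ = λ q h → own (∈-++⁻ D₁.A q) h
        ; small₀ = small-pebbled D₁
        ; cut = λ x y h → D₁.cut x h y
        ; claim = claim t₁ wl₁ wd₁ D₁ }
        where
        sub : ∀ {t} → t ∈ D₁.A ⊎ t ∈ D₁.B → t ∈ L⁺
        sub (inj₁ a) = ∈-++⁺ˡ a
        sub (inj₂ b) = ∈-++⁺ʳ D₁.A (B₁⊆ b)
        own : ∀ {t} → t ∈ D₁.A ⊎ t ∈ D₂.A ++ D.B → γ t₁ t ≡ true → t ∈ pebbled D₁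
        own (inj₁ a) _ = ∈-++⁺ˡ a
        own (inj₂ q) h = ⊥-elim (outside₁ q h)
      p₂ = record
        { X = λ x → γ t₂ x ; L₀ = pebbled D₂ ; N = D₂.N ; supp = supp-pebbled D₂
        ; L₀⊆L = λ q → sub (∈-++⁻ D₂.A q)
        ; X∩L⊆L₀ = λ q h → own (∈-++⁻ D₁.A q) h
        ; small₀ = small-pebbled D₂
        ; cut = λ x y h → D₂.cut x h y
        ; claim = claim t₂ wl₂ wd₂ D₂ }
        where
        sub : ∀ {t} → t ∈ D₂.A ⊎ t ∈ D₂.B → t ∈ L⁺
        sub (inj₁ a) = ∈-++⁺ʳ D₁.A (∈-++⁺ˡ a)
        sub (inj₂ b) with ∈-++⁻ D₁.A (B₂⊆ b)
        ... | inj₁ a₁ = ∈-++⁺ˡ a₁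
        ... | inj₂ b∈ = ∈-++⁺ʳ D₁.A (∈-++⁺ʳ D₂.A b∈)
        own : ∀ {t} → t ∈ D₁.A ⊎ t ∈ D₂.A ++ D.B → γ t₂ t ≡ true → t ∈ pebbled D₂
        own (inj₁ a) h = ⊥-elim (outside₂ (∈-++⁺ˡ a) h)
        own (inj₂ q) h with ∈-++⁻ D₂.A q
        ... | inj₁ a = ∈-++⁺ˡ a
        ... | inj₂ b = ⊥-elim (outside₂ (∈-++⁺ʳ D₁.A b) h)
      U-X : ∀ {x} → X x ≡ true → Union.U p₁ p₂ small true id x
      U-X {x} h with γ t₁ x in eq₁ | γ t₂ x in eq₂
      ... | true  | _     = inj₁ (x , eq₁ , W-refl)
      ... | false | true  = inj₂ (x , eq₂ , W-refl)
      ... | false | false = ⊥-elim (true≢false (trans (sym h) (trans (union x) (cong₂ _∨_ eq₁ eq₂))))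
      S⊆U : ∀ {x} → SCC true id D.N v x → Union.U p₁ p₂ small true id x
      S⊆U s = U-X (reach-inside (λ x y h → D.cut x h y) v∈X (proj₁ s))
      S'⊆U' : ∀ {x} → SCC b ρ⁺ D.N v' x → Union.U p₁ p₂ small b ρ⁺ x
      S'⊆U' {x'} s' = Union.U-W p₁ p₂ small (W-weaken id head-⊆ (proj₂ back))
          (S⊆U (W-SCC (supp-pebbled D) (small-pebbled D)
            (W-sym (W-weaken L⊆L⁺ swap-⊆ (proj₂ back))) s'))
        where
        back = W-back w⁺ (ℕₚ.≤-trans (ℕₚ.n≤1+n _) small) x'

    -- With a zero form the residual is plain adjacency, so the pieces are connected components.
    -- Gluing them reuses `Union` with an empty second part.
    isomorphic-if : (X : VSet G) → (∀ x → X x ≡ true) → Claim X [] (λ _ _ → false) → DN (Iso (Gr false) G)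
    isomorphic-if X full claim = do
      φ , _ ← Union.union-iso p₁ p₂ small false ρ v₀ (proj₁ start) (everything v₀) (proj₂ start)
      return (mk↔ₛ′ (from φ) (to φ) (λ x → from-to φ (everything x)) (λ y → to-from φ (everything' y)) ,
        (λ x y → trans (cong₂ (adj (Gr false)) (sym (to-from φ (everything' x))) (sym (to-from φ (everything' y))))
          (sym (adj-to φ (from-in φ (everything' x)) (from-in φ (everything' y))))) ,
        (λ y → trans (cong (col (Gr false)) (sym (to-from φ (everything' y))))
          (sym (proj₁ (W-pair (col-to φ (from-in φ (everything' y))) (here refl) (here refl))))))
      where
      small : 2 ≤ suc m
      small = ℕₚ.≤-trans (s≤s (s≤s z≤n)) 3k≤
      p₁ p₂ : Part []
      p₁ = record { X = X ; L₀ = [] ; N = λ _ _ → false ; supp = λ () ; L₀⊆L = λ () ; X∩L⊆L₀ = λ ()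
        ; small₀ = small ; cut = λ _ y _ y∉ → ⊥-elim (true≢false (trans (sym (full y)) y∉)) ; claim = claim }
      p₂ = record { X = λ _ → false ; L₀ = [] ; N = λ _ _ → false ; supp = λ () ; L₀⊆L = λ () ; X∩L⊆L₀ = λ ()
        ; small₀ = small ; cut = λ _ _ () ; claim = λ _ _ _ _ () }
      v₀ : V G
      v₀ = proj₁ (realised true true) fz
      ρ : V G → Vx false
      ρ _ = proj₁ (proj₂ (realised true false)) fz
      nothing : W true false id ρ [] []
      nothing = mkW λ u v h → ⊥-elim (absurd (h fz))
        where
        absurd : ∀ {p : V G × Vx false} → ¬ (p ∈ [])
        absurd ()
      start = W-forth nothing z≤n v₀
      everything : ∀ x → Union.U p₁ p₂ small true id x
      everything x = inj₁ (x , full x , W-refl)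
      everything' : ∀ y → Union.U p₁ p₂ small false ρ y
      everything' y with W-back nothing z≤n y
      ... | x , wx = inj₁ (x , full x , wx)

    -- The cut at the root has no columns, so the induction starts there without pebbles.
    isomorphic : (T : LTree G) → IsRankDecomposition G T → Width≤ G T k → DN (Iso (Gr false) G)
    isomorphic T (full , wl) wd = isomorphic-if (γ T) full (claim T wl wd D)
      where
      D : Split (γ T) k
      D = record
        { A = [] ; B = [] ; N = λ _ _ → false ; inside = λ () ; outside = λ () ; unique = []
        ; independent = λ c c⊆ _ v → ¬true⇒false (λ h → none (c⊆ h))
        ; |A|≤k = z≤n ; |B|≤k = z≤n ; supported = λ ()
        ; cut = λ x _ y y∉ → ⊥-elim (true≢false (trans (sym (full y)) y∉)) }
        where
        none : ∀ {t : V G} → ¬ (t ∈ [])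
        none ()

-- A colour present in one graph only

root-vertex : ∀ {G} (T : LTree G) → WellLabelled T → V G
root-vertex (leaf _)     (v , _)            = v
root-vertex (node _ t _) (_ , _ , wl , _) = root-vertex t wl

theorem1p1 : (k : ℕ) → 1 ≤ k → (G : Graph) → RankWidth≤ G k →
    (H : Graph) → ¬ Iso H G → Distinguishes (3 * k + 4) G H
theorem1p1 k _ G (T , decomposition , width) H ¬iso =
  -- The colour of `c` at round `N₀` is attained in `G` by `c` and by no tuple of `H`, so a
  -- bijection of colour classes would produce an impossible tuple.
  subst (λ l → Distinguishes l G H) (sym ℓ≡) (N₀ , inj₁ (c , λ bijection → nowhere (Inverse.to bijection (c ,ᵣ [ sameColour-refl N₀ c ]))))
  where
  m ℓ : ℕ
  m = 3 * k + 2
  ℓ = suc (suc m)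
  ℓ≡ : 3 * k + 4 ≡ ℓ
  ℓ≡ = trans (ℕₚ.+-suc (3 * k) 3) (cong suc (ℕₚ.+-suc (3 * k) 2))
  Gr : Bool → Graph
  Gr b = if b then G else H
  -- A sum of the four bounds, so that all pairs of sides are stable at the same round.
  N₀ : ℕ
  N₀ = (pairs ℓ G G + pairs ℓ G H) + (pairs ℓ H G + pairs ℓ H H)
  c : Tuple ℓ G
  c _ = root-vertex T (proj₂ decomposition)
  by-N₀ : ∀ {K L} → pairs ℓ K L ≤ N₀ → DN (Stable ℓ N₀ K L)
  by-N₀ {K} {L} le = do
    st ← stabilises ℓ K L
    return (subst (λ i → Stable ℓ i K L) (ℕₚ.m∸n+n≡m le) (stable-≤ (N₀ ∸ pairs ℓ K L) st))
  impossible : (v : Tuple ℓ H) → SameColour ℓ N₀ H G v c → ⊥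
  impossible v same = contradiction id
    where
    realised : (a b : Bool) → Realised ℓ N₀ (Gr a) (Gr b)
    realised true  true  = c , c , sameColour-refl N₀ c
    realised true  false = c , v , sameColour-sym N₀ same
    realised false true  = v , c , same
    realised false false = v , v , sameColour-refl N₀ v
    contradiction : DN ⊥
    contradiction = do
      s₁ ← by-N₀ {G} {G} (ℕₚ.≤-trans (ℕₚ.m≤m+n _ _) (ℕₚ.m≤m+n _ _))
      s₂ ← by-N₀ {G} {H} (ℕₚ.≤-trans (ℕₚ.m≤n+m _ (pairs ℓ G G)) (ℕₚ.m≤m+n _ _))
      s₃ ← by-N₀ {H} {G} (ℕₚ.≤-trans (ℕₚ.m≤m+n _ _) (ℕₚ.m≤n+m _ (pairs ℓ G G + pairs ℓ G H)))
      s₄ ← by-N₀ {H} {H} (ℕₚ.≤-trans (ℕₚ.m≤n+m _ (pairs ℓ H G)) (ℕₚ.m≤n+m _ (pairs ℓ G G + pairs ℓ G H)))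
      let stable : (a b : Bool) → Stable ℓ N₀ (Gr a) (Gr b)
          stable = λ { true true → s₁ ; true false → s₂ ; false true → s₃ ; false false → s₄ }
      σ ← Game.Decomposition.isomorphic m N₀ Gr stable realised k
            (s≤s (subst (_≤ m) (ℕₚ.+-comm (3 * k) 1) (ℕₚ.+-monoʳ-≤ (3 * k) (s≤s z≤n)))) T decomposition width
      return (¬iso σ)
  nowhere : ¬ ColourClass ℓ N₀ H G c
  -- The colour proof in a refinement is irrelevant and may only be used to reach `⊥`, which is all
  -- that is needed.
  nowhere (v ,ᵣ [ same ]) = ⊥-elim-irr (impossible v same)
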